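{- Let $S,T:\mathbb{F}_q^n\to\mathbb{F}_q^n$ be nilpotent $\mathbb{F}_q$-linear maps. Then $T\sim S$ if and only if the sequences of Jordan block lengths in the Jordan canonical forms of $S$ and $T$ coincide up to a permutation. In particular, if $P(k)$ is the number of partitions of the integer $k$ and $B_q(k)$ is the number of pairwise non-isomorphic functional graphs $G(T/\mathbb{F}_q^k)$ arising from bijective $\mathbb{F}_q$-linear maps $T:\mathbb{F}_q^k\to\mathbb{F}_q^k$, then $$A_q(n)=\sum_{k=0}^n P(k)\,B_q(n-k),$$ where $A_q(n)$ is the number of pairwise non-isomorphic functional graphs arising from all $\mathbb{F}_q$-linear maps $\mathbb{F}_q^n\to\mathbb{F}_q^n$.
   Context: For finite sets $X,Y$, maps $S:X\to X$ and $T:Y\to Y$ are dynamically equivalent, written $T\sim S$, if there is a bijection $f:X\to Y$ with $S=f^{ -1}\circ T\circ f$. For a linear map $T$ on $\mathbb{F}_q^k$, the functional graph $G(T/\mathbb{F}_q^k)$ is the directed graph with vertex set $\mathbb{F}_q^k$ and edges $v\to T(v)$. Conventionally $P(0)=B_q(0)=1$ (the zero-dimensional space contributes one graph). -}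

module Defs where

open import Data.Nat using (ℕ; zero; suc; _<_; _≥_; _≡ᵇ_)
open import Data.Fin using (Fin; toℕ)
open import Data.Vec using (Vec; tabulate; lookup)
open import Data.List using (List; []; _∷_; length; map)
open import Data.Bool.ListAction using (any)
open import Data.Nat.ListAction using (sum)
open import Data.List.Relation.Unary.All using (All)
open import Data.List.Relation.Unary.Any using (Any)
open import Data.List.Relation.Unary.AllPairs using (AllPairs)
open import Data.List.Relation.Unary.Linked using (Linked)
open import Data.Bool using (Bool; true; false; if_then_else_; _∧_; not)
open import Data.Product using (Σ; ∃; _×_; _,_)
open import Relation.Nullary using (¬_)
open import Relation.Binary.PropositionalEquality using (_≡_)
open import Algebra.Core using (Op₁; Op₂)
open import Algebra.Structures using (IsCommutativeRing)
open import Function.Bundles using (_↔_)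

-- Counting equivalence classes: `HasCard P R c` says that the elements
-- satisfying P fall into exactly c classes w.r.t. the relation R, i.e.
-- there is a list of c elements satisfying P, pairwise non-R-related,
-- such that every element satisfying P is R-related to one of them.

HasCard : {A : Set} → (A → Set) → (A → A → Set) → ℕ → Set
HasCard {A} P R c =
  Σ (List A) λ xs →
    (length xs ≡ c) × All P xs × AllPairs (λ x y → ¬ R x y) xs
      × (∀ x → P x → Any (R x) xs)

IsPartition : ℕ → List ℕ → Set
IsPartition k λs = Linked _≥_ λs × All (0 <_) λs × sum λs ≡ k

PartitionCount : ℕ → ℕ → Set
PartitionCount k p = HasCard (IsPartition k) _≡_ p

sumTo : ℕ → (ℕ → ℕ) → ℕ
sumTo zero    f = f 0
sumTo (suc n) f = sumTo n f Data.Nat.+ f (suc n)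

record FiniteField : Set₁ where
  field
    Carrier : Set
    _+_ _*_ : Op₂ Carrier
    -_      : Op₁ Carrier
    0# 1#   : Carrier
    isCommutativeRing : IsCommutativeRing _≡_ _+_ _*_ -_ 0# 1#
    0≢1     : ¬ (0# ≡ 1#)
    inverse : ∀ x → ¬ (x ≡ 0#) → ∃ λ y → (x * y) ≡ 1#
    size    : ℕ
    enum    : Carrier ↔ Fin size

-- Linear algebra over a finite field.  Linear maps 𝔽_q^n → 𝔽_q^n are
-- represented by their n×n matrices; vectors of 𝔽_q^n by `Vec F n`.

module LinAlg (𝔽 : FiniteField) where
  open FiniteField 𝔽

  F : Set
  F = Carrier

  Matrix : ℕ → Set
  Matrix n = Fin n → Fin n → F

  Σ[_] : ∀ n → (Fin n → F) → F
  Σ[ zero  ] f = 0#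
  Σ[ suc n ] f = f Fin.zero + Σ[ n ] (λ i → f (Fin.suc i))
    where import Data.Fin as Fin

  _≐_ : ∀ {n} → Matrix n → Matrix n → Set
  M ≐ N = ∀ i j → M i j ≡ N i j

  _·_ : ∀ {n} → Matrix n → Matrix n → Matrix n
  _·_ {n} M N i j = Σ[ n ] (λ k → M i k * N k j)

  idM : ∀ {n} → Matrix n
  idM i j = if toℕ i ≡ᵇ toℕ j then 1# else 0#

  zeroM : ∀ {n} → Matrix n
  zeroM i j = 0#

  _^_ : ∀ {n} → Matrix n → ℕ → Matrix n
  M ^ zero  = idM
  M ^ suc k = M · (M ^ k)

  act : ∀ {n} → Matrix n → Vec F n → Vec F n
  act {n} M v = tabulate (λ i → Σ[ n ] (λ k → M i k * lookup v k))

  Nilpotent : ∀ {n} → Matrix n → Set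
  Nilpotent M = ∃ λ k → (M ^ k) ≐ zeroM

  Invertible : ∀ {n} → Matrix n → Set
  Invertible M = ∃ λ N → ((M · N) ≐ idM) × ((N · M) ≐ idM)

  blockStarts : List ℕ → List ℕ
  blockStarts []         = []
  blockStarts (l ∷ λs) = 0 ∷ map (l Data.Nat.+_) (blockStarts λs)

  -- The nilpotent Jordan matrix with blocks of lengths λs (in this order)
  -- along the diagonal: entry (i , i+1) is 1 unless i+1 starts a new block.
  jordan : ∀ {n} → List ℕ → Matrix n
  jordan λs i j =
    if (toℕ j ≡ᵇ suc (toℕ i)) ∧ not (any (_≡ᵇ toℕ j) (blockStarts λs))
    then 1# else 0#

  -- λs is the sequence of Jordan block lengths of a Jordan canonical
  -- form of the nilpotent matrix S : P⁻¹ S P = J(λs) for an invertible P.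
  JordanType : ∀ {n} → Matrix n → List ℕ → Set
  JordanType {n} S λs =
    All (0 <_) λs × sum λs ≡ n
      × ∃ λ P → Invertible P × ((S · P) ≐ (P · jordan λs))

  -- Dynamical equivalence T ∼ S of the maps on 𝔽_q^n: a bijection f with
  -- S = f⁻¹ ∘ T ∘ f (equivalently f ∘ S = T ∘ f).  This is exactly an
  -- isomorphism of the functional graphs G(S/𝔽_q^n) and G(T/𝔽_q^n).
  _∼_ : ∀ {n} → Matrix n → Matrix n → Set
  _∼_ {n} T S =
    Σ (Vec F n → Vec F n) λ f → Σ (Vec F n → Vec F n) λ g →
      (∀ v → g (f v) ≡ v) × (∀ v → f (g v) ≡ v)
        × (∀ v → f (act S v) ≡ act T (f v))

  AllCount : ℕ → ℕ → Set
  AllCount n a = HasCard {Matrix n} (λ _ → Data.Unit.⊤) _∼_ a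
    where import Data.Unit

  BijCount : ℕ → ℕ → Set
  BijCount k b = HasCard {Matrix k} Invertible _∼_ b

{-# OPTIONS --safe #-}

-- Call a self-map t : X → X a system, and factor it through its image as
-- t = ι ∘ p with p onto and ι injective; then p ∘ ι is t restricted to its image.
-- The restriction depends only on the isomorphism class of t.  Conversely, if all
-- fibres of p are copies of a fixed set K, then K and the restriction determine t:
-- a bijection over the isomorphism of the restrictions can be corrected inside the
-- fibres by transpositions.  So no linear change of basis is needed to see, by
-- induction on the dimension, that every linear map is dynamically equivalent to
-- a sum of nilpotent shifts and an invertible map: passing from the image of T
-- back to T lengthens each Jordan block by one and adds blocks of length one.
--
-- For the converse, restricting a system with block lengths λᵢ and invertible part
-- of dimension m to its image k times leaves q^(Σ(λᵢ ∸ k) + m) points.  These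
-- numbers determine m and the partition λ, and for large k only the invertible
-- part is left.

module Submission where

open import Defs
open import Algebra.Bundles using (CommutativeRing)
import Algebra.Properties.Ring
import Algebra.Solver.Ring.NaturalCoefficients.Default
open import Data.Bool using (true; false; if_then_else_; _∧_; _∨_; not)
open import Data.Bool.ListAction using (any)
open import Data.Fin as Fin using (Fin; zero; suc; toℕ; _↑ˡ_; _↑ʳ_)
import Data.Fin.Properties as Fin
open import Data.List as List using (List; []; _∷_; map; length)
open import Data.List.Membership.Propositional.Properties using (∈-map⁺; ∈-allFin; ∈-lookup)
import Data.List.Properties as List
open import Data.List.Relation.Binary.Permutation.Propositional as Perm
  using (_↭_; ↭-sym; ↭-trans; ↭-reflexive)
open import Data.List.Relation.Binary.Permutation.Propositional.Properties
  using (All-resp-↭)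
open import Data.List.Relation.Unary.All as All using (All; []; _∷_)
import Data.List.Relation.Unary.All.Properties as All
open import Data.List.Relation.Unary.AllPairs using (AllPairs; []; _∷_)
open import Data.List.Relation.Unary.Any as Any using (Any)
open import Data.List.Relation.Unary.Any.Properties using (lookup-index)
open import Data.List.Relation.Unary.Linked as Linked using (Linked; []; [-]; _∷_)
import Data.List.Relation.Unary.Linked.Properties as Linked
import Data.List.Sort
open import Data.Nat as ℕ using (ℕ; zero; suc; pred; _∸_; _≤_; _<_; _≥_; z≤n; s≤s; _≡ᵇ_)
open import Data.Nat.Induction using (<-rec)
open import Data.Nat.ListAction using (sum)
open import Data.Nat.ListAction.Properties using (sum-++)
import Data.Nat.Properties as ℕ
open import Data.Product as Product using (Σ; ∃; _×_; _,_; proj₁; proj₂)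
open import Data.Product.Function.NonDependent.Propositional using (_×-↔_)
open import Data.Sum using (_⊎_; inj₁; inj₂)
open import Data.Sum.Function.Propositional using (_⊎-↔_)
open import Data.Unit using (⊤; tt)
open import Data.Vec as Vec using
  (Vec; []; _∷_; _++_; _∷ʳ_; zipWith; replicate; tabulate; lookup; head; tail; take; drop)
import Data.Vec.Properties as Vec
open import Function using (_∘_; id)
open import Function.Bundles using (_↔_; mk↔ₛ′; Inverse; _⇔_; mk⇔)
open import Function.Definitions using (Injective)
open import Function.Properties.Inverse using (↔-refl; ↔-sym; ↔-trans)
open import Relation.Binary.Construct.Flip.EqAndOrd using (decTotalOrder)
open import Relation.Binary.Definitions using (DecidableEquality; Symmetric; Transitive)
open import Relation.Binary.PropositionalEquality hiding (J)
open import Relation.Nullary using (¬_; Dec; yes; no; contradiction)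
open import Relation.Nullary.Decidable using (map′)

-- Bijections, isomorphic self-maps and their products

module _ {A B : Set} (b : A ↔ B) where
  open Inverse b

  ↔-injective : Injective _≡_ _≡_ to
  ↔-injective {x} {y} eq = trans (sym (strictlyInverseʳ x))
    (trans (cong from eq) (strictlyInverseʳ y))

Finite : Set → Set
Finite A = ∃ λ n → A ↔ Fin n

infix 4 _≅_

record _≅_ {X Y : Set} (s : X → X) (t : Y → Y) : Set where
  constructor conj
  field
    bijection : X ↔ Y
  open Inverse bijection public
  field
    commute : ∀ x → to (s x) ≡ t (to x)

  commute⁻¹ : ∀ y → from (t y) ≡ s (from y)
  commute⁻¹ y = trans (cong (from ∘ t) (sym (strictlyInverseˡ y)))
    (trans (cong from (sym (commute (from y)))) (strictlyInverseʳ _))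

module _ {X : Set} {s : X → X} where

  ≅-reflexive : {t : X → X} → (∀ x → s x ≡ t x) → s ≅ t
  ≅-reflexive eq = conj ↔-refl eq

  ≅-refl : s ≅ s
  ≅-refl = ≅-reflexive (λ _ → refl)

  module _ {Y : Set} {t : Y → Y} where

    ≅-sym : s ≅ t → t ≅ s
    ≅-sym e = conj (↔-sym bijection) commute⁻¹ where open _≅_ e

    ≅-trans : {Z : Set} {u : Z → Z} → s ≅ t → t ≅ u → s ≅ u
    ≅-trans e f = conj (↔-trans E.bijection F.bijection)
      (λ x → trans (cong F.to (E.commute x)) (F.commute (E.to x)))
      where module E = _≅_ e
            module F = _≅_ f

infixr 5 _⊗_

_⊗_ : {X Y : Set} → (X → X) → (Y → Y) → X × Y → X × Y
s ⊗ t = Product.map s t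

⊗-cong : {X X′ Y Y′ : Set} {s : X → X} {s′ : X′ → X′} {t : Y → Y} {t′ : Y′ → Y′} →
         s ≅ s′ → t ≅ t′ → s ⊗ t ≅ s′ ⊗ t′
⊗-cong e f = conj (E.bijection ×-↔ F.bijection)
  (λ (x , y) → cong₂ _,_ (E.commute x) (F.commute y))
  where module E = _≅_ e
        module F = _≅_ f

⊗-assoc : {X Y Z : Set} {s : X → X} {t : Y → Y} {u : Z → Z} → (s ⊗ t) ⊗ u ≅ s ⊗ (t ⊗ u)
⊗-assoc = conj (mk↔ₛ′ (λ ((x , y) , z) → x , y , z) (λ (x , y , z) → (x , y) , z)
  (λ _ → refl) (λ _ → refl)) (λ _ → refl)

⊗-comm : {X Y : Set} {s : X → X} {t : Y → Y} → s ⊗ t ≅ t ⊗ s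
⊗-comm = conj (mk↔ₛ′ Product.swap Product.swap (λ _ → refl) (λ _ → refl)) (λ _ → refl)

-- Transpositions inside fibres

module _ {Z : Set} (_≟_ : DecidableEquality Z) where

  swap : Z → Z → Z → Z
  swap a b z with z ≟ a
  ... | yes _ = b
  ... | no _ with z ≟ b
  ...   | yes _ = a
  ...   | no _ = z

  swap-left : ∀ a b → swap a b a ≡ b
  swap-left a b with a ≟ a
  ... | yes _ = refl
  ... | no a≢a = contradiction refl a≢a

  swap-right : ∀ a b → swap a b b ≡ a
  swap-right a b with b ≟ a
  ... | yes b≡a = b≡a
  ... | no _ with b ≟ b
  ...   | yes _ = refl
  ...   | no b≢b = contradiction refl b≢b

  swap-involutive : ∀ a b z → swap a b (swap a b z) ≡ z
  swap-involutive a b z with z ≟ a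
  ... | yes z≡a = trans (swap-right a b) (sym z≡a)
  ... | no z≢a with z ≟ b
  ...   | yes z≡b = trans (swap-left a b) (sym z≡b)
  ...   | no z≢b with z ≟ a
  ...     | yes z≡a = contradiction z≡a z≢a
  ...     | no _ with z ≟ b
  ...       | yes z≡b = contradiction z≡b z≢b
  ...       | no _ = refl

  -- Weaker hypotheses than `z` differing from both points: a transposition with `a ≡ b` moves
  -- nothing. This lets `align` run over lists with repetitions.
  swap-other : ∀ {a b z} → (z ≡ a → a ≡ b) → (z ≡ b → a ≡ b) → swap a b z ≡ z
  swap-other {a} {b} {z} f g with z ≟ a
  ... | yes z≡a = sym (trans z≡a (f z≡a))
  ... | no _ with z ≟ b
  ...   | yes z≡b = trans (g z≡b) (sym z≡b)
  ...   | no _ = refl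

  swap-fibre : {W : Set} (p : Z → W) → ∀ {a b} → p a ≡ p b → ∀ z → p (swap a b z) ≡ p z
  swap-fibre p {a} {b} eq z with z ≟ a
  ... | yes z≡a = trans (sym eq) (cong p (sym z≡a))
  ... | no _ with z ≟ b
  ...   | yes z≡b = trans eq (cong p (sym z≡b))
  ...   | no _ = refl

  -- One point is corrected at a time, by transposing its current image with its target. Both lie in
  -- the same fibre of `p`, so `h` stays over the identity. By injectivity of `i` and `j` an earlier
  -- point can meet this transposition only if it equals `y`, and then the transposition is trivial.
  align : {W Y : Set} (p : Z → W) (i j : Y → Z) → Injective _≡_ _≡_ i → Injective _≡_ _≡_ j →
          (∀ y → p (i y) ≡ p (j y)) → (ys : List Y) →
          Σ (Z ↔ Z) λ h → (∀ z → p (Inverse.to h z) ≡ p z) ×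
                          All (λ y → Inverse.to h (i y) ≡ j y) ys
  align p i j i-inj j-inj eq [] = ↔-refl , (λ _ → refl) , []
  align p i j i-inj j-inj eq (y ∷ ys) with align p i j i-inj j-inj eq ys
  ... | h , p∘h , aligned = ↔-trans h h′ , p∘h′ , swap-left a b ∷ All.map keep aligned
    where
    open Inverse h using (to)
    a = to (i y)
    b = j y
    h′ = mk↔ₛ′ (swap a b) (swap a b) (swap-involutive a b) (swap-involutive a b)

    p∘h′ : ∀ z → p (swap a b (to z)) ≡ p z
    p∘h′ z = trans (swap-fibre p (trans (p∘h (i y)) (eq y)) (to z)) (p∘h z)

    keep : ∀ {y′} → to (i y′) ≡ j y′ → swap a b (to (i y′)) ≡ j y′
    keep {y′} eq′ = trans (swap-other
      (λ e → fixed (i-inj (↔-injective h e)))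
      (λ e → fixed (j-inj (trans (sym eq′) e)))) eq′
      where
      fixed : y′ ≡ y → a ≡ b
      fixed refl = eq′

-- Restriction of a self-map to its image

-- t′ is (isomorphic to) the restriction of t to its image; all fibres of t are
-- copies of K.
record Collapse (K : Set) {X Y : Set} (t : X → X) (t′ : Y → Y) : Set where
  field
    split       : X ↔ (Y × K)
    ι           : Y → X
    ι-injective : Injective _≡_ _≡_ ι

  p : X → Y
  p x = proj₁ (Inverse.to split x)

  field
    factors : ∀ x → t x ≡ ι (p x)
    induced : ∀ y → t′ y ≡ p (ι y)

module _ {K L X X′ Y Y′ : Set} {t : X → X} {t′ : Y → Y} {u : X′ → X′} {u′ : Y′ → Y′}
         (c : Collapse K t t′) (d : Collapse L u u′) (k : K) (e : t ≅ u) where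
  private
    module C = Collapse c
    module D = Collapse d
    module E = _≅_ e

  -- The element `k` picks one preimage under `p`. By `restrict-ι` and injectivity of `D.ι` the
  -- result does not depend on that choice.
  restrict : Y → Y′
  restrict y = D.p (E.to (Inverse.from C.split (y , k)))

  -- The chosen `x` lies over `y`, so `t x` is `C.ι y`, and the isomorphism carries values of `t` to
  -- values of `u`.
  restrict-ι : ∀ y → D.ι (restrict y) ≡ E.to (C.ι y)
  restrict-ι y = begin
    D.ι (D.p (E.to x))  ≡⟨ D.factors _ ⟨
    u (E.to x)          ≡⟨ E.commute x ⟨
    E.to (t x)          ≡⟨ cong E.to (C.factors x) ⟩
    E.to (C.ι (C.p x))  ≡⟨ cong (E.to ∘ C.ι ∘ proj₁) (Inverse.strictlyInverseˡ C.split (y , k)) ⟩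
    E.to (C.ι y)        ∎
    where
    open ≡-Reasoning
    x = Inverse.from C.split (y , k)

-- Behind the embeddings `ι`, the maps `f` and `g` are the two directions of the given isomorphism,
-- so every identity is checked after applying an injective `ι`. The fibres `K` and `L` may differ;
-- they only have to be inhabited.
collapse-≅ : {K L X X′ Y Y′ : Set} {t : X → X} {t′ : Y → Y} {u : X′ → X′} {u′ : Y′ → Y′} →
             Collapse K t t′ → Collapse L u u′ → K → L → t ≅ u → t′ ≅ u′
collapse-≅ {t = t} {t′} {u} {u′} c d k l e = conj (mk↔ₛ′ f g f∘g g∘f) comm
  where
  module C = Collapse c
  module D = Collapse d
  module E = _≅_ e
  f = restrict c d k e
  g = restrict d c l (≅-sym e)

  f∘g : ∀ y → f (g y) ≡ y
  f∘g y = D.ι-injective (trans (restrict-ι c d k e (g y))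
    (trans (cong E.to (restrict-ι d c l (≅-sym e) y)) (E.strictlyInverseˡ _)))

  g∘f : ∀ y → g (f y) ≡ y
  g∘f y = C.ι-injective (trans (restrict-ι d c l (≅-sym e) (f y))
    (trans (cong E.from (restrict-ι c d k e y)) (E.strictlyInverseʳ _)))

  open ≡-Reasoning

  comm : ∀ y → f (t′ y) ≡ u′ (f y)
  comm y = D.ι-injective (begin
    D.ι (f (t′ y))           ≡⟨ restrict-ι c d k e (t′ y) ⟩
    E.to (C.ι (t′ y))        ≡⟨ cong (E.to ∘ C.ι) (C.induced y) ⟩
    E.to (C.ι (C.p (C.ι y))) ≡⟨ cong E.to (C.factors (C.ι y)) ⟨
    E.to (t (C.ι y))         ≡⟨ E.commute (C.ι y) ⟩
    u (E.to (C.ι y))         ≡⟨ cong u (restrict-ι c d k e y) ⟨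
    u (D.ι (f y))            ≡⟨ D.factors _ ⟩
    D.ι (D.p (D.ι (f y)))    ≡⟨ cong D.ι (D.induced (f y)) ⟨
    D.ι (u′ (f y))           ∎)

-- Any bijection between the total spaces that lies over t′ ≅ u′ can be corrected
-- fibrewise until it also matches the two embeddings ι.
extend-≅ : {K X X′ Y Y′ : Set} {t : X → X} {t′ : Y → Y} {u : X′ → X′} {u′ : Y′ → Y′} →
           DecidableEquality X′ → Finite Y →
           Collapse K t t′ → Collapse K u u′ → t′ ≅ u′ → t ≅ u
extend-≅ {K} {X} {X′} {Y} {t = t} {t′} {u} {u′} _≟_ (N , enum) c d e =
  conj (↔-trans g h) comm
  where
  module C = Collapse c
  module D = Collapse d
  module E = _≅_ e
  open ≡-Reasoning

  g : X ↔ X′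
  g = ↔-trans C.split (↔-trans (E.bijection ×-↔ ↔-refl) (↔-sym D.split))

  module G = Inverse g

  p∘g : ∀ x → D.p (G.to x) ≡ E.to (C.p x)
  p∘g x = cong proj₁ (Inverse.strictlyInverseˡ D.split _)

  -- Since `p ∘ ι` is the restricted map on either side, this is the commutation of the isomorphism
  -- between the restrictions.
  sameFibre : ∀ y → D.p (G.to (C.ι y)) ≡ D.p (D.ι (E.to y))
  sameFibre y = begin
    D.p (G.to (C.ι y))   ≡⟨ p∘g (C.ι y) ⟩
    E.to (C.p (C.ι y))   ≡⟨ cong E.to (C.induced y) ⟨
    E.to (t′ y)          ≡⟨ E.commute y ⟩
    u′ (E.to y)          ≡⟨ D.induced _ ⟩
    D.p (D.ι (E.to y))   ∎

  aligned = align _≟_ D.p (G.to ∘ C.ι) (D.ι ∘ E.to)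
    (C.ι-injective ∘ ↔-injective g) (↔-injective E.bijection ∘ D.ι-injective)
    sameFibre (List.map (Inverse.from enum) (List.allFin N))

  h = proj₁ aligned
  module H = Inverse h

  h-aligned : ∀ y → H.to (G.to (C.ι y)) ≡ D.ι (E.to y)
  h-aligned y = subst (λ z → H.to (G.to (C.ι z)) ≡ D.ι (E.to z))
    (Inverse.strictlyInverseʳ enum y)
    (All.lookup (proj₂ (proj₂ aligned)) (∈-map⁺ (Inverse.from enum) (∈-allFin (Inverse.to enum y))))

  comm : ∀ x → H.to (G.to (t x)) ≡ u (H.to (G.to x))
  comm x = begin
    H.to (G.to (t x))          ≡⟨ cong (H.to ∘ G.to) (C.factors x) ⟩
    H.to (G.to (C.ι (C.p x)))  ≡⟨ h-aligned (C.p x) ⟩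
    D.ι (E.to (C.p x))         ≡⟨ cong D.ι (p∘g x) ⟨
    D.ι (D.p (G.to x))         ≡⟨ cong D.ι (proj₁ (proj₂ aligned) (G.to x)) ⟨
    D.ι (D.p (H.to (G.to x)))  ≡⟨ D.factors _ ⟨
    u (H.to (G.to x))          ∎

-- Counting classes by index sets

Fin↔⇒≡ : ∀ {m n} → Fin m ↔ Fin n → m ≡ n
Fin↔⇒≡ b = ℕ.≤-antisym (Fin.injective⇒≤ (↔-injective b)) (Fin.injective⇒≤ (↔-injective (↔-sym b)))

-- `HasCard` with an arbitrary index set in place of a list, so that two systems of representatives
-- are compared by a bijection. Distinctness is stated positively, which yields equalities of
-- indices directly.
record Classes {A : Set} (P : A → Set) (R : A → A → Set) (I : Set) : Set where
  field
    rep      : I → A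
    rep-sat  : ∀ i → P (rep i)
    distinct : ∀ i j → R (rep i) (rep j) → i ≡ j
    classify : ∀ x → P x → ∃ λ i → R x (rep i)

module _ {A : Set} {P : A → Set} {R : A → A → Set} where

  -- Going to the other system and back gives a chain from `rep i` to a representative of the same
  -- system, which must then be `rep i` itself.
  Classes-unique : Transitive R → ∀ {I J} → Classes P R I → Classes P R J → I ↔ J
  Classes-unique tran C D = mk↔ₛ′ (match C D) (match D C) (inverse D C) (inverse C D)
    where
    open Classes
    match : ∀ {I J} → Classes P R I → Classes P R J → I → J
    match C D i = proj₁ (classify D (rep C i) (rep-sat C i))

    inverse : ∀ {I J} (C : Classes P R I) (D : Classes P R J) → ∀ i → match D C (match C D i) ≡ i
    inverse C D i = sym (distinct C _ _ (tran (proj₂ (classify D (rep C i) (rep-sat C i)))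
      (proj₂ (classify C (rep D j) (rep-sat D j)))))
      where j = match C D i

  AllPairs-lookup : Symmetric R → ∀ {xs} → AllPairs (λ x y → ¬ R x y) xs →
                    ∀ i j → R (List.lookup xs i) (List.lookup xs j) → i ≡ j
  AllPairs-lookup symm (_ ∷ _) zero zero r = refl
  AllPairs-lookup symm {x ∷ xs} (x∉ ∷ _) zero (suc j) r =
    contradiction r (All.lookup x∉ (∈-lookup {xs = xs} j))
  AllPairs-lookup symm {x ∷ xs} (x∉ ∷ _) (suc i) zero r =
    contradiction (symm r) (All.lookup x∉ (∈-lookup {xs = xs} i))
  AllPairs-lookup symm (_ ∷ ps) (suc i) (suc j) r = cong suc (AllPairs-lookup symm ps i j r)

  HasCard⇒Classes : Symmetric R → ∀ {c} → HasCard P R c → Classes P R (Fin c)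
  HasCard⇒Classes symm (xs , refl , sat , pairs , cover) = record
    { rep      = List.lookup xs
    ; rep-sat  = λ i → All.lookup sat (∈-lookup i)
    ; distinct = AllPairs-lookup symm pairs
    ; classify = λ x px → Any.index (cover x px) , lookup-index (cover x px)
    }

-- A finite disjoint union has the sum of the sizes; the induction splits off the top summand
-- `k ≡ suc n`.
sumTo-↔ : (G : ℕ → Set) (f : ℕ → ℕ) → (∀ k → G k ↔ Fin (f k)) →
          ∀ n → (∃ λ k → k ≤ n × G k) ↔ Fin (sumTo n f)
sumTo-↔ G f enum zero = ↔-trans
  (mk↔ₛ′ (λ { (zero , _ , g) → g }) (λ g → 0 , z≤n , g) (λ _ → refl) λ { (zero , z≤n , g) → refl })
  (enum 0)
sumTo-↔ G f enum (suc n) = ↔-trans (mk↔ₛ′ to from to∘from from∘to)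
  (↔-trans (sumTo-↔ G f enum n ⊎-↔ enum (suc n)) (↔-sym Fin.+↔⊎))
  where
  -- The case distinction is an explicit argument, so that a `with` on it in the round trips makes
  -- `to` compute.
  to′ : ∀ {k} → k ≤ suc n → G k → k < suc n ⊎ k ≡ suc n → (∃ λ k → k ≤ n × G k) ⊎ G (suc n)
  to′ _ g (inj₁ k<) = inj₁ (_ , ℕ.s≤s⁻¹ k< , g)
  to′ _ g (inj₂ refl) = inj₂ g

  to : (∃ λ k → k ≤ suc n × G k) → (∃ λ k → k ≤ n × G k) ⊎ G (suc n)
  to (k , k≤ , g) = to′ k≤ g (ℕ.m≤n⇒m<n∨m≡n k≤)

  from : (∃ λ k → k ≤ n × G k) ⊎ G (suc n) → ∃ λ k → k ≤ suc n × G k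
  from (inj₁ (k , k≤ , g)) = k , ℕ.m≤n⇒m≤1+n k≤ , g
  from (inj₂ g) = suc n , ℕ.≤-refl , g

  to∘from : ∀ x → to (from x) ≡ x
  to∘from (inj₁ (k , k≤ , g)) with ℕ.m≤n⇒m<n∨m≡n (ℕ.m≤n⇒m≤1+n k≤)
  ... | inj₁ k< = cong (λ p → inj₁ (k , p , g)) (ℕ.≤-irrelevant _ _)
  ... | inj₂ refl = contradiction k≤ ℕ.1+n≰n
  to∘from (inj₂ g) with ℕ.m≤n⇒m<n∨m≡n {suc n} ℕ.≤-refl
  ... | inj₁ n< = contradiction n< (ℕ.<-irrefl refl)
  ... | inj₂ refl = refl

  from∘to : ∀ x → from (to x) ≡ x
  from∘to (k , k≤ , g) with ℕ.m≤n⇒m<n∨m≡n k≤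
  ... | inj₁ k< = cong (λ p → k , p , g) (ℕ.≤-irrelevant _ _)
  ... | inj₂ refl = cong (λ p → suc n , p , g) (ℕ.≤-irrelevant _ _)

-- Recovering a partition from its truncated sums

sum-∸≡0 : ∀ {k ls} → All (_≤ k) ls → sum (map (_∸ k) ls) ≡ 0
sum-∸≡0 [] = refl
sum-∸≡0 {k} (l≤k ∷ ps) = cong₂ ℕ._+_ (ℕ.m≤n⇒m∸n≡0 l≤k) (sum-∸≡0 ps)

All-≤-head : ∀ {l ls} → Linked _≥_ (l ∷ ls) → All (_≤ l) (l ∷ ls)
All-≤-head lk = Linked.Linked⇒All (λ p q → ℕ.≤-trans q p) ℕ.≤-refl lk

descending-unique : ∀ {ls ms} → Linked _≥_ ls → Linked _≥_ ms → All (0 <_) ls → All (0 <_) ms →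
                    (∀ k → sum (map (_∸ k) ls) ≡ sum (map (_∸ k) ms)) → ls ≡ ms
descending-unique {[]} {[]} _ _ _ _ _ = refl
descending-unique {[]} {m ∷ ms} _ _ _ (s≤s _ ∷ _) eq = contradiction (eq 0) λ ()
descending-unique {l ∷ ls} {[]} _ _ (s≤s _ ∷ _) _ eq = contradiction (eq 0) λ ()
descending-unique {l ∷ ls} {m ∷ ms} sl sm (_ ∷ pl) (_ ∷ pm) eq
  with ℕ.≤-antisym (head≤ ls sm (sym ∘ eq)) (head≤ ms sl eq)
  where
  head≤ : ∀ {a as b} bs → Linked _≥_ (a ∷ as) →
          (∀ k → sum (map (_∸ k) (a ∷ as)) ≡ sum (map (_∸ k) (b ∷ bs))) → b ≤ a
  head≤ {a} {as} {b} bs sorted eq =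
    ℕ.m∸n≡0⇒m≤n (ℕ.m+n≡0⇒m≡0 (b ∸ a) (trans (sym (eq a)) (sum-∸≡0 (All-≤-head sorted))))
... | refl = cong (l ∷_) (descending-unique (Linked.tail sl) (Linked.tail sm) pl pm
      (λ k → ℕ.+-cancelˡ-≡ (l ∸ k) _ _ (eq k)))

-- Splitting and comparing vectors

++-↔ : ∀ {A : Set} m n → (Vec A m × Vec A n) ↔ Vec A (m ℕ.+ n)
++-↔ m n = mk↔ₛ′ (λ (u , v) → u ++ v) (λ w → take m w , drop m w) (Vec.take++drop≡id m)
  (λ (u , v) → cong₂ _,_ (Vec.++-injectiveˡ _ u (Vec.take++drop≡id m (u ++ v)))
                         (Vec.++-injectiveʳ _ u (Vec.take++drop≡id m (u ++ v))))

tabulate-++ : ∀ {A : Set} m {n} (f : Fin (m ℕ.+ n) → A) →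
              tabulate f ≡ tabulate (λ i → f (i ↑ˡ n)) ++ tabulate (λ i → f (m ↑ʳ i))
tabulate-++ zero    f = refl
tabulate-++ (suc m) f = cong (f zero ∷_) (tabulate-++ m (f ∘ suc))

lookup-ext : ∀ {A : Set} {n} (u v : Vec A n) → (∀ i → lookup u i ≡ lookup v i) → u ≡ v
lookup-ext u v eq = trans (sym (Vec.tabulate∘lookup u))
  (trans (Vec.tabulate-cong eq) (Vec.tabulate∘lookup v))

-- Finite vector spaces and linear maps

module Field (𝔽 : FiniteField) where
  open FiniteField 𝔽
  open LinAlg 𝔽

  commutativeRing : CommutativeRing _ _
  commutativeRing = record { isCommutativeRing = isCommutativeRing }

  open CommutativeRing commutativeRing public using
    ( ring; commutativeSemiring; +-comm; +-assoc; +-identityˡ; +-identityʳ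
    ; *-comm; *-identityˡ; *-identityʳ; zeroˡ; zeroʳ; distribʳ
    ; -‿inverseˡ; -‿inverseʳ)
  open Algebra.Properties.Ring ring public using (x∙y⁻¹≈ε⇒x≈y; -1*x≈-x)
  module Solver = Algebra.Solver.Ring.NaturalCoefficients.Default commutativeSemiring
  open Solver using (solve; _:=_; _:+_; _:*_)

  V : ℕ → Set
  V = Vec F

  _≟_ : DecidableEquality F
  x ≟ y = map′ (↔-injective enum) (cong (Inverse.to enum))
    (Inverse.to enum x Fin.≟ Inverse.to enum y)

  _≟ⱽ_ : ∀ {n} → DecidableEquality (V n)
  _≟ⱽ_ = Vec.≡-dec _≟_

  V-enum : ∀ n → V n ↔ Fin (size ℕ.^ n)
  V-enum zero = mk↔ₛ′ (λ _ → zero) (λ _ → []) (λ { zero → refl }) λ { [] → refl }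
  V-enum (suc n) = ↔-trans
    (mk↔ₛ′ (λ v → head v , tail v) (λ (x , v) → x ∷ v) (λ _ → refl) λ { (x ∷ v) → refl })
    (↔-trans (enum ×-↔ V-enum n) (↔-sym Fin.*↔×))

  1<size : 1 ℕ.< size
  1<size with size | enum
  ... | 0 | e = contradiction (Inverse.to e 0#) λ ()
  ... | 1 | e = contradiction (↔-injective e (fin1 _ _)) 0≢1
    where
    fin1 : (i j : Fin 1) → i ≡ j
    fin1 zero zero = refl
  ... | suc (suc _) | _ = ℕ.s≤s (ℕ.s≤s ℕ.z≤n)

  -- Compare the cardinalities `size ^ m` and `size ^ n`. As `f` is any injection of sets, dimension
  -- is an invariant of bare bijections.
  V-injection⇒≤ : ∀ {m n} {f : V m → V n} → Injective _≡_ _≡_ f → m ℕ.≤ n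
  V-injection⇒≤ {m} {n} {f} inj = ℕ.≮⇒≥ λ n<m →
    ℕ.<⇒≱ (ℕ.^-monoʳ-< size 1<size n<m)
      (Fin.injective⇒≤ {f = Inverse.to (V-enum n) ∘ f ∘ Inverse.from (V-enum m)}
        (↔-injective (↔-sym (V-enum m)) ∘ inj ∘ ↔-injective (V-enum n)))

  V-↔⇒≡ : ∀ {m n} → V m ↔ V n → m ≡ n
  V-↔⇒≡ b = ℕ.≤-antisym (V-injection⇒≤ (↔-injective b)) (V-injection⇒≤ (↔-injective (↔-sym b)))

  any-V? : ∀ {n} {Q : V n → Set} → (∀ v → Dec (Q v)) → Dec (∃ Q)
  any-V? {n} {Q} Q? = map′ (λ (i , q) → from i , q)
    (λ (v , q) → to v , subst Q (sym (strictlyInverseʳ v)) q) (Fin.any? (Q? ∘ from))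
    where open Inverse (V-enum n)

  infixr 5 _∙_⊕_

  -- Scaling and addition in a single operation, so that linearity is one equation.
  _∙_⊕_ : ∀ {n} → F → V n → V n → V n
  a ∙ u ⊕ v = zipWith (λ x y → (a * x) + y) u v

  𝟘 : ∀ {n} → V n
  𝟘 = replicate _ 0#

  ∙⊕-interchange : ∀ {n} c x y (a p q : V n) →
    ((c * x) + y) ∙ a ⊕ (c ∙ p ⊕ q) ≡ c ∙ (x ∙ a ⊕ p) ⊕ (y ∙ a ⊕ q)
  ∙⊕-interchange c x y [] [] [] = refl
  ∙⊕-interchange c x y (a ∷ as) (p ∷ ps) (q ∷ qs) = cong₂ _∷_
    (solve 6 (λ c x y a p q → (c :* x :+ y) :* a :+ (c :* p :+ q)
                            := c :* (x :* a :+ p) :+ (y :* a :+ q)) refl c x y a p q)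
    (∙⊕-interchange c x y as ps qs)

  ∙⊕-cancel : ∀ {n} x y → x + y ≡ 0# → (a v : V n) → x ∙ a ⊕ (y ∙ a ⊕ v) ≡ v
  ∙⊕-cancel x y eq [] [] = refl
  ∙⊕-cancel x y eq (a ∷ as) (v ∷ vs) = cong₂ _∷_ (begin
    (x * a) + ((y * a) + v)
      ≡⟨ solve 4 (λ x y a v → x :* a :+ (y :* a :+ v) := (x :+ y) :* a :+ v) refl x y a v ⟩
    ((x + y) * a) + v       ≡⟨ cong (λ z → (z * a) + v) eq ⟩
    (0# * a) + v            ≡⟨ cong (_+ v) (zeroˡ a) ⟩
    0# + v                  ≡⟨ +-identityˡ v ⟩
    v                       ∎) (∙⊕-cancel x y eq as vs)
    where open ≡-Reasoning

  ∙⊕-injectiveʳ : ∀ {n} x (a : V n) {u v} → x ∙ a ⊕ u ≡ x ∙ a ⊕ v → u ≡ v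
  ∙⊕-injectiveʳ x a eq = trans (sym (∙⊕-cancel (- x) x (-‿inverseˡ x) a _))
    (trans (cong ((- x) ∙ a ⊕_) eq) (∙⊕-cancel (- x) x (-‿inverseˡ x) a _))

  ∙𝟘⊕ : ∀ {n} x (v : V n) → x ∙ 𝟘 ⊕ v ≡ v
  ∙𝟘⊕ x [] = refl
  ∙𝟘⊕ x (v ∷ vs) = cong₂ _∷_ (trans (cong (_+ v) (zeroʳ x)) (+-identityˡ v)) (∙𝟘⊕ x vs)

  ∷-decompose : ∀ {n} x (v : V n) → x ∙ (1# ∷ 𝟘) ⊕ (0# ∷ v) ≡ x ∷ v
  ∷-decompose x v = cong₂ _∷_ (trans (+-identityʳ _) (*-identityʳ x)) (∙𝟘⊕ x v)

  -- Here `d` is the inverse of `x - y`, and `c` is `d` times `v - u`. The same `d` works for all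
  -- vectors and dimensions.
  ∙⊕-solve : ∀ {x y} → ¬ (x ≡ y) →
             ∃ λ d → ∀ {n} (c u v : V n) → x ∙ c ⊕ u ≡ y ∙ c ⊕ v → c ≡ d ∙ ((- 1#) ∙ u ⊕ v) ⊕ 𝟘
  ∙⊕-solve {x} {y} x≢y = d , go
    where
    open ≡-Reasoning
    inv = inverse (x + (- y)) (x≢y ∘ x∙y⁻¹≈ε⇒x≈y x y)
    d = proj₁ inv

    scalar : ∀ c u v → (x * c) + u ≡ (y * c) + v → c ≡ (d * (((- 1#) * u) + v)) + 0#
    scalar c u v eq = sym (begin
      (d * (((- 1#) * u) + v)) + 0#
        ≡⟨ +-identityʳ _ ⟩
      d * (((- 1#) * u) + v)
        ≡⟨ cong (λ z → d * (((- 1#) * u) + z)) v≡ ⟩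
      d * (((- 1#) * u) + (((- y) * c) + ((x * c) + u)))
        -- The semiring solver knows no negation: `n` stands for `- 1#` and `y` for `- y`, both
        -- treated as atoms.
        ≡⟨ solve 6 (λ d n u y c x → d :* (n :* u :+ (y :* c :+ (x :* c :+ u)))
                  := (x :+ y) :* d :* c :+ d :* ((n :* u) :+ u)) refl d (- 1#) u (- y) c x ⟩
      (((x + (- y)) * d) * c) + (d * (((- 1#) * u) + u))
        ≡⟨ cong₂ (λ p q → (p * c) + (d * q)) (proj₂ inv) (trans (cong (_+ u) (-1*x≈-x u)) (-‿inverseˡ u)) ⟩
      (1# * c) + (d * 0#)
        ≡⟨ cong₂ _+_ (*-identityˡ c) (zeroʳ d) ⟩
      c + 0#
        ≡⟨ +-identityʳ c ⟩
      c ∎)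
      where
      v≡ : v ≡ ((- y) * c) + ((x * c) + u)
      v≡ = sym (begin
        ((- y) * c) + ((x * c) + u) ≡⟨ cong (((- y) * c) +_) eq ⟩
        ((- y) * c) + ((y * c) + v) ≡⟨ +-assoc _ _ _ ⟨
        (((- y) * c) + (y * c)) + v ≡⟨ cong (_+ v) (distribʳ c (- y) y) ⟨
        (((- y) + y) * c) + v       ≡⟨ cong (λ z → (z * c) + v) (-‿inverseˡ y) ⟩
        (0# * c) + v                ≡⟨ cong (_+ v) (zeroˡ c) ⟩
        0# + v                      ≡⟨ +-identityˡ v ⟩
        v                           ∎)

    go : ∀ {n} (c u v : V n) → x ∙ c ⊕ u ≡ y ∙ c ⊕ v → c ≡ d ∙ ((- 1#) ∙ u ⊕ v) ⊕ 𝟘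
    go [] [] [] _ = refl
    go (c ∷ cs) (u ∷ us) (v ∷ vs) eq = cong₂ _∷_
      (scalar c u v (Vec.∷-injectiveˡ eq)) (go cs us vs (Vec.∷-injectiveʳ eq))

  Linear : ∀ {m n} → (V m → V n) → Set
  Linear L = ∀ a u v → L (a ∙ u ⊕ v) ≡ a ∙ L u ⊕ L v

  module _ {m n} {L : V m → V n} (lin : Linear L) where

    -- Write the zero vector as minus itself plus itself; the image then cancels.
    linear-𝟘 : L 𝟘 ≡ 𝟘
    linear-𝟘 = begin
      L 𝟘                          ≡⟨ cong L (∙𝟘⊕ (- 1#) 𝟘) ⟨
      L ((- 1#) ∙ 𝟘 ⊕ 𝟘)           ≡⟨ lin (- 1#) 𝟘 𝟘 ⟩
      (- 1#) ∙ L 𝟘 ⊕ L 𝟘           ≡⟨ cong ((- 1#) ∙ L 𝟘 ⊕_) (1∙⊕𝟘 (L 𝟘)) ⟨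
      (- 1#) ∙ L 𝟘 ⊕ (1# ∙ L 𝟘 ⊕ 𝟘) ≡⟨ ∙⊕-cancel (- 1#) 1# (-‿inverseˡ 1#) (L 𝟘) 𝟘 ⟩
      𝟘                            ∎
      where
      open ≡-Reasoning
      1∙⊕𝟘 : ∀ {k} (v : V k) → 1# ∙ v ⊕ 𝟘 ≡ v
      1∙⊕𝟘 [] = refl
      1∙⊕𝟘 (x ∷ v) = cong₂ _∷_ (trans (+-identityʳ _) (*-identityˡ x)) (1∙⊕𝟘 v)

  linear-0∷ : ∀ {m n} {L : V (suc m) → V n} → Linear L → Linear (λ v → L (0# ∷ v))
  linear-0∷ {L = L} lin a u v = trans
    (cong (λ z → L (z ∷ (a ∙ u ⊕ v))) (sym (trans (+-identityʳ _) (zeroʳ a))))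
    (lin a (0# ∷ u) (0# ∷ v))

  linear-∷ : ∀ {m n} {L : V (suc m) → V n} → Linear L → ∀ x v →
             L (x ∷ v) ≡ x ∙ L (1# ∷ 𝟘) ⊕ L (0# ∷ v)
  linear-∷ {L = L} lin x v = trans (cong L (sym (∷-decompose x v))) (lin x (1# ∷ 𝟘) (0# ∷ v))

  ∙⊕-linear : ∀ {n m} {L : V n → V m} → Linear L → (a : V m) →
              Linear {suc n} (λ w → head w ∙ a ⊕ L (tail w))
  ∙⊕-linear {L = L} lin a c (x ∷ u) (y ∷ v) = trans
    (cong (((c * x) + y) ∙ a ⊕_) (lin c u v)) (∙⊕-interchange c x y a (L u) (L v))

  -- Rank factorization

  -- Here `r` is the rank and `s` the nullity. Only the first component of `split` has to be linear:
  -- that is enough for `p ∘ ι` to be linear, while the kernel coordinates serve merely to identify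
  -- fibres.
  record Factorization {n m} (L : V n → V m) : Set where
    field
      r s         : ℕ
      r+s≡n       : r ℕ.+ s ≡ n
      split       : V n ↔ (V r × V s)
      ι           : V r → V m
      ι-linear    : Linear ι
      ι-injective : Injective _≡_ _≡_ ι

    p : V n → V r
    p v = proj₁ (Inverse.to split v)

    field
      p-linear : Linear p
      factors  : ∀ v → L v ≡ ι (p v)

  -- Gaussian elimination: the next column c of L either lies in the image of ι
  -- (and enlarges the kernel) or is independent of it (and enlarges the rank).
  factorize : ∀ {n m} (L : V n → V m) → Linear L → Factorization L
  factorize {zero} L lin = record
    { r = 0; s = 0; r+s≡n = refl
    ; split = mk↔ₛ′ (λ v → v , []) proj₁ (λ { (_ , []) → refl }) (λ _ → refl)
    ; ι = L; ι-linear = lin; ι-injective = λ { {[]} {[]} _ → refl }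
    ; p-linear = λ _ _ _ → refl; factors = λ _ → refl }
  factorize {suc n} {m} L lin with factorize (λ v → L (0# ∷ v)) (linear-0∷ {L = L} lin)
  -- Membership in the image is decided by searching the finite space `V r`.
  ... | φ with any-V? (λ a → Factorization.ι φ a ≟ⱽ L (1# ∷ 𝟘))
  ...   | yes (a , ιa≡c) = record
    { r = r; s = suc s; r+s≡n = trans (ℕ.+-suc r s) (cong suc r+s≡n)
    ; split = mk↔ₛ′ to′ from′ to∘from from∘to
    ; ι = ι; ι-linear = ι-linear; ι-injective = ι-injective
    ; p-linear = λ { c u@(_ ∷ _) v@(_ ∷ _) → ∙⊕-linear p-linear a c u v }
    ; factors = λ { (x ∷ v) → begin
        L (x ∷ v)                        ≡⟨ linear-∷ lin x v ⟩
        x ∙ L (1# ∷ 𝟘) ⊕ L (0# ∷ v)      ≡⟨ cong₂ (x ∙_⊕_) (sym ιa≡c) (factors v) ⟩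
        x ∙ ι a ⊕ ι (p v)                ≡⟨ ι-linear x a (p v) ⟨
        ι (x ∙ a ⊕ p v)                  ∎ } }
    where
    open Factorization φ
    open Inverse split using (to; from; strictlyInverseˡ; strictlyInverseʳ)
    open ≡-Reasoning

    -- The new coordinate `x` becomes a kernel coordinate, and its contribution `x` times `a` is
    -- added to the image coordinate.
    to′ : V (suc n) → V r × V (suc s)
    to′ (x ∷ v) = x ∙ a ⊕ p v , x ∷ proj₂ (to v)

    from′ : V r × V (suc s) → V (suc n)
    from′ (w , x ∷ b) = x ∷ from ((- x) ∙ a ⊕ w , b)

    to∘from : ∀ z → to′ (from′ z) ≡ z
    to∘from (w , x ∷ b) rewrite strictlyInverseˡ ((- x) ∙ a ⊕ w , b) =
      cong (_, x ∷ b) (∙⊕-cancel x (- x) (-‿inverseʳ x) a w)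

    from∘to : ∀ v → from′ (to′ v) ≡ v
    from∘to (x ∷ v) = cong (x ∷_) (trans
      (cong (λ w → from (w , proj₂ (to v))) (∙⊕-cancel (- x) x (-‿inverseˡ x) a (p v)))
      (strictlyInverseʳ v))
  ...   | no c∉ι = record
    { r = suc r; s = s; r+s≡n = cong suc r+s≡n
    ; split = mk↔ₛ′ to′ from′ to∘from from∘to
    ; ι = λ w → head w ∙ c ⊕ ι (tail w)
    ; ι-linear = ∙⊕-linear ι-linear c
    ; ι-injective = inj
    ; p-linear = λ { b (x ∷ u) (y ∷ v) → cong (((b * x) + y) ∷_) (p-linear b u v) }
    ; factors = λ { (x ∷ v) → trans (linear-∷ lin x v) (cong (x ∙ c ⊕_) (factors v)) } }
    where
    open Factorization φ
    open Inverse split using (to; from; strictlyInverseˡ; strictlyInverseʳ)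
    c = L (1# ∷ 𝟘)

    to′ : V (suc n) → V (suc r) × V s
    to′ (x ∷ v) = x ∷ p v , proj₂ (to v)

    from′ : V (suc r) × V s → V (suc n)
    from′ (x ∷ w , b) = x ∷ from (w , b)

    to∘from : ∀ z → to′ (from′ z) ≡ z
    to∘from (x ∷ w , b) rewrite strictlyInverseˡ (w , b) = refl

    from∘to : ∀ v → from′ (to′ v) ≡ v
    from∘to (x ∷ v) = cong (x ∷_) (strictlyInverseʳ v)

    inj : Injective _≡_ _≡_ (λ w → head w ∙ c ⊕ ι (tail w))
    inj {x ∷ u} {y ∷ v} eq with x ≟ y
    ... | yes refl = cong (x ∷_) (ι-injective (∙⊕-injectiveʳ x c eq))
    -- Two different leading coefficients would allow solving for `c` inside the image of `ι`.
    ... | no x≢y = contradiction (d ∙ ((- 1#) ∙ u ⊕ v) ⊕ 𝟘 , (begin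
        ι (d ∙ ((- 1#) ∙ u ⊕ v) ⊕ 𝟘)        ≡⟨ ι-linear d _ 𝟘 ⟩
        d ∙ ι ((- 1#) ∙ u ⊕ v) ⊕ ι 𝟘        ≡⟨ cong₂ (d ∙_⊕_) (ι-linear (- 1#) u v) (linear-𝟘 ι-linear) ⟩
        d ∙ ((- 1#) ∙ ι u ⊕ ι v) ⊕ 𝟘        ≡⟨ sol c (ι u) (ι v) eq ⟨
        c                                   ∎)) c∉ι
      where
      open ≡-Reasoning
      d = proj₁ (∙⊕-solve x≢y)
      sol = proj₂ (∙⊕-solve x≢y)

  factorization⇒collapse : ∀ {n} {T : V n → V n} (φ : Factorization T) → let open Factorization φ in
                           Collapse (V s) T (p ∘ ι)
  factorization⇒collapse φ = record
    { split = split; ι = ι; ι-injective = ι-injective; factors = factors; induced = λ _ → refl }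
    where open Factorization φ

  -- Pigeonhole: a missed `w` could be added to the images, injecting a set with one element too
  -- many into `V n`.
  injective⇒surjective : ∀ {n} {L : V n → V n} → Injective _≡_ _≡_ L → ∀ w → ∃ λ v → L v ≡ w
  injective⇒surjective {n} {L} inj w with any-V? (λ v → L v ≟ⱽ w)
  ... | yes hit = hit
  ... | no miss = contradiction (Fin.injective⇒≤ g-injective) ℕ.1+n≰n
    where
    open Inverse (V-enum n)
    g : Fin (suc (size ℕ.^ n)) → Fin (size ℕ.^ n)
    g zero = to w
    g (suc i) = to (L (from i))

    g-injective : Injective _≡_ _≡_ g
    g-injective {zero} {zero} _ = refl
    g-injective {zero} {suc j} eq = contradiction (_ , sym (↔-injective (V-enum n) eq)) miss
    g-injective {suc i} {zero} eq = contradiction (_ , ↔-injective (V-enum n) eq) miss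
    g-injective {suc i} {suc j} eq =
      cong suc (↔-injective (↔-sym (V-enum n)) (inj (↔-injective (V-enum n) eq)))

-- Boolean tests on block positions

≡ᵇ-false-above : ∀ {m n} → m ℕ.< n → (n ≡ᵇ m) ≡ false
≡ᵇ-false-above {zero}  {suc n} _ = refl
≡ᵇ-false-above {suc m} {suc n} (ℕ.s≤s m<n) = ≡ᵇ-false-above m<n

≡ᵇ-false-below : ∀ {m n} → m ℕ.< n → (m ≡ᵇ n) ≡ false
≡ᵇ-false-below {zero}  {suc n} _ = refl
≡ᵇ-false-below {suc m} {suc n} (ℕ.s≤s m<n) = ≡ᵇ-false-below m<n

≡ᵇ-refl : ∀ n → (n ≡ᵇ n) ≡ true
≡ᵇ-refl zero = refl
≡ᵇ-refl (suc n) = ≡ᵇ-refl n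

+-≡ᵇ : ∀ l m n → ((l ℕ.+ m) ≡ᵇ (l ℕ.+ n)) ≡ (m ≡ᵇ n)
+-≡ᵇ zero m n = refl
+-≡ᵇ (suc l) m n = +-≡ᵇ l m n

any-shift-small : ∀ {l j} → j ℕ.< l → ∀ bs → any (_≡ᵇ j) (map (l ℕ.+_) bs) ≡ false
any-shift-small j<l [] = refl
any-shift-small {l} j<l (b ∷ bs) =
  cong₂ _∨_ (≡ᵇ-false-above (ℕ.<-≤-trans j<l (ℕ.m≤m+n l b))) (any-shift-small j<l bs)

any-shift : ∀ l j bs → any (_≡ᵇ (l ℕ.+ j)) (map (l ℕ.+_) bs) ≡ any (_≡ᵇ j) bs
any-shift l j [] = refl
any-shift l j (b ∷ bs) = cong₂ _∨_ (+-≡ᵇ l b j) (any-shift l j bs)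

-- Matrices as linear maps

module Matrices (𝔽 : FiniteField) where
  open FiniteField 𝔽
  open LinAlg 𝔽
  open Field 𝔽
  open Solver using (solve; _:=_; _:+_; _:*_)

  Σ-cong : ∀ {n} {f g : Fin n → F} → (∀ i → f i ≡ g i) → Σ[ n ] f ≡ Σ[ n ] g
  Σ-cong {zero} eq = refl
  Σ-cong {suc n} eq = cong₂ _+_ (eq zero) (Σ-cong (eq ∘ suc))

  Σ-zero : ∀ {n} {f : Fin n → F} → (∀ i → f i ≡ 0#) → Σ[ n ] f ≡ 0#
  Σ-zero {zero} eq = refl
  Σ-zero {suc n} eq = trans (cong₂ _+_ (eq zero) (Σ-zero (eq ∘ suc))) (+-identityˡ 0#)

  Σ-++ : ∀ m {n} (f : Fin (m ℕ.+ n) → F) →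
         Σ[ m ℕ.+ n ] f ≡ Σ[ m ] (λ i → f (i ↑ˡ n)) + Σ[ n ] (λ i → f (m ↑ʳ i))
  Σ-++ zero f = sym (+-identityˡ _)
  Σ-++ (suc m) f = trans (cong (f zero +_) (Σ-++ m (f ∘ suc))) (sym (+-assoc _ _ _))

  Σ-linear : ∀ {n} (f : Fin n → F) a u v →
             Σ[ n ] (λ k → f k * lookup (a ∙ u ⊕ v) k) ≡
             (a * Σ[ n ] (λ k → f k * lookup u k)) + Σ[ n ] (λ k → f k * lookup v k)
  Σ-linear f a [] [] = sym (trans (+-identityʳ _) (zeroʳ a))
  Σ-linear f a (x ∷ u) (y ∷ v) = trans (cong ((f zero * ((a * x) + y)) +_) (Σ-linear (f ∘ suc) a u v))
    (solve 6 (λ f a x y p q → f :* (a :* x :+ y) :+ (a :* p :+ q)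
                            := a :* (f :* x :+ p) :+ (f :* y :+ q)) refl (f zero) a x y _ _)

  basis : ∀ {n} → Fin n → V n
  basis j = tabulate (λ i → idM i j)

  Σ-basis : ∀ {n} (f : Fin n → F) j → Σ[ n ] (λ k → f k * lookup (basis j) k) ≡ f j
  Σ-basis {suc n} f zero = trans (cong₂ _+_ (*-identityʳ _)
    (Σ-zero (λ k → trans (cong (f (suc k) *_) (Vec.lookup∘tabulate _ k)) (zeroʳ _)))) (+-identityʳ _)
  Σ-basis {suc n} f (suc j) = trans (cong₂ _+_ (zeroʳ _) (Σ-basis (f ∘ suc) j)) (+-identityˡ _)

  act-linear : ∀ {n} (M : Matrix n) → Linear (act M)
  act-linear M a u v = lookup-ext _ _ λ i → begin
    lookup (act M (a ∙ u ⊕ v)) i            ≡⟨ Vec.lookup∘tabulate _ i ⟩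
    Σ[ _ ] (λ k → M i k * lookup (a ∙ u ⊕ v) k) ≡⟨ Σ-linear (M i) a u v ⟩
    _
      ≡⟨ cong₂ (λ x y → (a * x) + y) (Vec.lookup∘tabulate _ i) (Vec.lookup∘tabulate _ i) ⟨
    _                                       ≡⟨ Vec.lookup-zipWith _ i (act M u) (act M v) ⟨
    lookup (a ∙ act M u ⊕ act M v) i        ∎
    where open ≡-Reasoning

  act-basis : ∀ {n} (M : Matrix n) i j → lookup (act M (basis j)) i ≡ M i j
  act-basis M i j = trans (Vec.lookup∘tabulate _ i) (Σ-basis (M i) j)

  act-cong : ∀ {n} {M N : Matrix n} → M ≐ N → ∀ v → act M v ≡ act N v
  act-cong eq v = Vec.tabulate-cong (λ i → Σ-cong (λ k → cong (_* lookup v k) (eq i k)))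

  act-faithful : ∀ {n} {M N : Matrix n} → (∀ v → act M v ≡ act N v) → M ≐ N
  act-faithful {M = M} {N} eq i j =
    trans (sym (act-basis M i j)) (trans (cong (λ v → lookup v i) (eq (basis j))) (act-basis N i j))

  toMatrix : ∀ {n} → (V n → V n) → Matrix n
  toMatrix L i j = lookup (L (basis j)) i

  functional-expand : ∀ {n} (ℓ : V n → F) → (∀ a u v → ℓ (a ∙ u ⊕ v) ≡ (a * ℓ u) + ℓ v) →
                      ∀ v → Σ[ n ] (λ k → ℓ (basis k) * lookup v k) ≡ ℓ v
  -- In dimension zero, linearity with scalar `- 1#` forces `ℓ []` to vanish.
  functional-expand ℓ lin [] = sym (trans (lin (- 1#) [] [])
    (trans (cong (_+ ℓ []) (-1*x≈-x (ℓ []))) (-‿inverseˡ (ℓ []))))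
  functional-expand ℓ lin (x ∷ v) = begin
    (ℓ (basis zero) * x) + _
      ≡⟨ cong₂ _+_ (*-comm _ x) (functional-expand (ℓ ∘ (0# ∷_)) lin′ v) ⟩
    (x * ℓ (basis zero)) + ℓ (0# ∷ v)     ≡⟨ lin x (basis zero) (0# ∷ v) ⟨
    ℓ (x ∙ basis zero ⊕ (0# ∷ v))
      ≡⟨ cong (λ z → ℓ (x ∙ (1# ∷ z) ⊕ (0# ∷ v))) (lookup-ext _ 𝟘 λ i →
           trans (Vec.lookup∘tabulate _ i) (sym (Vec.lookup-replicate i 0#))) ⟩
    ℓ (x ∙ (1# ∷ 𝟘) ⊕ (0# ∷ v))       ≡⟨ cong ℓ (∷-decompose x v) ⟩
    ℓ (x ∷ v)                         ∎
    where
    open ≡-Reasoning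
    lin′ : ∀ a u v → ℓ (0# ∷ (a ∙ u ⊕ v)) ≡ (a * ℓ (0# ∷ u)) + ℓ (0# ∷ v)
    lin′ a u v = trans (cong (λ z → ℓ (z ∷ (a ∙ u ⊕ v))) (sym (trans (+-identityʳ _) (zeroʳ a))))
      (lin a (0# ∷ u) (0# ∷ v))

  act-toMatrix : ∀ {n} {L : V n → V n} → Linear L → ∀ v → act (toMatrix L) v ≡ L v
  act-toMatrix {L = L} lin v = lookup-ext _ _ λ i → trans (Vec.lookup∘tabulate _ i)
    (functional-expand (λ u → lookup (L u) i)
      (λ a u w → trans (cong (λ z → lookup z i) (lin a u w)) (Vec.lookup-zipWith _ i (L u) (L w))) v)

  -- The product is by its columns the matrix of the composite map, so `act-toMatrix` applies and no
  -- double sum has to be interchanged.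
  act-· : ∀ {n} (M N : Matrix n) v → act (M · N) v ≡ act M (act N v)
  act-· M N v = trans (act-cong entry v) (act-toMatrix linear v)
    where
    linear : Linear (act M ∘ act N)
    linear a u w = trans (cong (act M) (act-linear N a u w)) (act-linear M a (act N u) (act N w))

    entry : (M · N) ≐ toMatrix (act M ∘ act N)
    entry i j = sym (trans (Vec.lookup∘tabulate _ i) (Σ-cong (λ k → cong (M i k *_) (act-basis N k j))))

  act-id : ∀ {n} (v : V n) → act idM v ≡ v
  act-id v = trans (act-cong (λ i j → sym (Vec.lookup∘tabulate _ i)) v)
    (act-toMatrix {L = id} (λ _ _ _ → refl) v)

  act-inverse : ∀ {n} {M N : Matrix n} → (M · N) ≐ idM → ∀ v → act M (act N v) ≡ v
  act-inverse {M = M} {N} eq v = trans (sym (act-· M N v)) (trans (act-cong eq v) (act-id v))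

  act-↔ : ∀ {n} {M : Matrix n} → Invertible M → V n ↔ V n
  act-↔ {M = M} (N , MN , NM) = mk↔ₛ′ (act M) (act N) (act-inverse MN) (act-inverse NM)

  linear-bijection⇒Invertible : ∀ {n} (b : V n ↔ V n) → Linear (Inverse.to b) →
                                Invertible (toMatrix (Inverse.to b))
  linear-bijection⇒Invertible b lin = toMatrix from ,
    act-faithful (λ v → trans (act-· (toMatrix to) (toMatrix from) v)
      (trans (act-toMatrix lin _) (trans (cong to (act-toMatrix lin⁻¹ v))
      (trans (strictlyInverseˡ v) (sym (act-id v)))))) ,
    act-faithful (λ v → trans (act-· (toMatrix from) (toMatrix to) v)
      (trans (act-toMatrix lin⁻¹ _) (trans (cong from (act-toMatrix lin v))
      (trans (strictlyInverseʳ v) (sym (act-id v))))))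
    where
    open Inverse b
    lin⁻¹ : Linear from
    lin⁻¹ a u v = ↔-injective b (trans (strictlyInverseˡ _)
      (sym (trans (lin a (from u) (from v)) (cong₂ (a ∙_⊕_) (strictlyInverseˡ u) (strictlyInverseˡ v)))))

  -- Block diagonal matrices

  module _ {m n} (M : Matrix (m ℕ.+ n)) (A : Matrix m) (B : Matrix n)
           (upperLeft  : ∀ i j → M (i ↑ˡ n) (j ↑ˡ n) ≡ A i j)
           (upperRight : ∀ i j → M (i ↑ˡ n) (m ↑ʳ j) ≡ 0#)
           (lowerLeft  : ∀ i j → M (m ↑ʳ i) (j ↑ˡ n) ≡ 0#)
           (lowerRight : ∀ i j → M (m ↑ʳ i) (m ↑ʳ j) ≡ B i j) where

    -- Phrased through the four quadrants to serve both `diag`, which splits indices, and `jordan`,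
    -- which tests positions.
    act-blocks : ∀ u v → act M (u ++ v) ≡ act A u ++ act B v
    act-blocks u v = trans (tabulate-++ m _) (cong₂ _++_
      (Vec.tabulate-cong λ i → trans (Σ-++ m _) (trans (cong₂ _+_
        (Σ-cong λ k → cong₂ _*_ (upperLeft i k) (Vec.lookup-++ˡ u v k))
        (Σ-zero λ k → trans (cong (_* _) (upperRight i k)) (zeroˡ _))) (+-identityʳ _)))
      (Vec.tabulate-cong λ i → trans (Σ-++ m _) (trans (cong₂ _+_
        (Σ-zero λ k → trans (cong (_* _) (lowerLeft i k)) (zeroˡ _))
        (Σ-cong λ k → cong₂ _*_ (lowerRight i k) (Vec.lookup-++ʳ u v k))) (+-identityˡ _))))

    blocks-≅ : act A ⊗ act B ≅ act M
    blocks-≅ = conj (++-↔ m n) (λ (u , v) → sym (act-blocks u v))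

  diag : ∀ {m n} → Matrix m → Matrix n → Matrix (m ℕ.+ n)
  diag {m} A B i j with Fin.splitAt m i | Fin.splitAt m j
  ... | inj₁ i′ | inj₁ j′ = A i′ j′
  ... | inj₂ i′ | inj₂ j′ = B i′ j′
  ... | inj₁ _  | inj₂ _  = 0#
  ... | inj₂ _  | inj₁ _  = 0#

  diag-≅ : ∀ {m n} (A : Matrix m) (B : Matrix n) → act A ⊗ act B ≅ act (diag A B)
  diag-≅ {m} {n} A B = blocks-≅ (diag A B) A B ul ur ll lr
    where
    ul : ∀ i j → diag A B (i ↑ˡ n) (j ↑ˡ n) ≡ A i j
    ul i j rewrite Fin.splitAt-↑ˡ m i n | Fin.splitAt-↑ˡ m j n = refl
    ur : ∀ i j → diag A B (i ↑ˡ n) (m ↑ʳ j) ≡ 0#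
    ur i j rewrite Fin.splitAt-↑ˡ m i n | Fin.splitAt-↑ʳ m n j = refl
    ll : ∀ i j → diag A B (m ↑ʳ i) (j ↑ˡ n) ≡ 0#
    ll i j rewrite Fin.splitAt-↑ʳ m n i | Fin.splitAt-↑ˡ m j n = refl
    lr : ∀ i j → diag A B (m ↑ʳ i) (m ↑ʳ j) ≡ B i j
    lr i j rewrite Fin.splitAt-↑ʳ m n i | Fin.splitAt-↑ʳ m n j = refl

  0*+ : ∀ x y → (0# * x) + y ≡ y
  0*+ x y = trans (cong (_+ y) (zeroˡ x)) (+-identityˡ y)

  -- Nilpotent shifts and Jordan matrices

  -- The action of one nilpotent Jordan block. This form shows its factorization: drop the first
  -- coordinate, then append a zero.
  shift : ∀ {n} → V n → V n
  shift [] = []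
  shift (x ∷ v) = v ∷ʳ 0#

  -- Coordinate `i` of `v`, with a natural number as index so that `i = n` is allowed; it then gives
  -- the appended zero.
  δ-sum : ∀ {n} → V n → ℕ → F
  δ-sum {n} v i = Σ[ n ] (λ k → (if toℕ k ≡ᵇ i then 1# else 0#) * lookup v k)

  tabulate-δ : ∀ {n} (v : V n) → tabulate {n = suc n} (λ i → δ-sum v (toℕ i)) ≡ v ∷ʳ 0#
  tabulate-δ [] = refl
  tabulate-δ (x ∷ v) = cong₂ _∷_
    (trans (cong₂ _+_ (*-identityˡ x) (Σ-zero (λ k → zeroˡ (lookup v k)))) (+-identityʳ x))
    (trans (Vec.tabulate-cong (λ i → 0*+ x (δ-sum v (toℕ i)))) (tabulate-δ v))

  jordanBlock : ∀ {n} → Matrix n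
  jordanBlock i j = if toℕ j ≡ᵇ suc (toℕ i) then 1# else 0#

  act-jordanBlock : ∀ {n} (v : V n) → act jordanBlock v ≡ shift v
  act-jordanBlock [] = refl
  act-jordanBlock (x ∷ v) =
    trans (Vec.tabulate-cong (λ i → 0*+ x (δ-sum v (toℕ i)))) (tabulate-δ v)

  Blocks : List ℕ → Set
  Blocks []       = ⊤
  Blocks (l ∷ ls) = V l × Blocks ls

  -- The direct sum of nilpotent Jordan blocks. Length zero is allowed and gives a one-point system,
  -- so that restricting to the image is simply `map pred` on the list.
  nil : ∀ ls → Blocks ls → Blocks ls
  nil []       = id
  nil (l ∷ ls) = shift ⊗ nil ls

  jordanEntry : List ℕ → ℕ → ℕ → F
  jordanEntry ls i j =
    if (j ≡ᵇ suc i) ∧ not (any (_≡ᵇ j) (blockStarts ls)) then 1# else 0#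

  -- The start `0` affects only column zero, which holds no superdiagonal entry, and all later
  -- starts are at least `l`.
  entry-upperLeft : ∀ l ls i j → j ℕ.< l → jordanEntry (l ∷ ls) i j ≡ (if j ≡ᵇ suc i then 1# else 0#)
  entry-upperLeft l ls i zero    _   = refl
  entry-upperLeft l ls i (suc j) j<l rewrite any-shift-small j<l (blockStarts ls) with j ≡ᵇ i
  ... | true  = refl
  ... | false = refl

  -- The superdiagonal meets this quadrant only in its corner, in column `l`, and there the start of
  -- the next block suppresses the entry.
  entry-upperRight : ∀ l l₂ ls i j → i ℕ.< l → jordanEntry (l ∷ l₂ ∷ ls) i (l ℕ.+ j) ≡ 0#
  entry-upperRight l l₂ ls i zero _ rewrite ≡ᵇ-refl (l ℕ.+ 0)
    with (l ℕ.+ 0) ≡ᵇ suc i | 0 ≡ᵇ (l ℕ.+ 0)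
  ... | true  | true  = refl
  ... | true  | false = refl
  ... | false | _     = refl
  entry-upperRight l l₂ ls i (suc j) i<l
    rewrite ℕ.+-suc l j | ≡ᵇ-false-above (ℕ.<-≤-trans i<l (ℕ.m≤m+n l j)) = refl

  entry-lowerLeft : ∀ l ls i j → j ℕ.< l → jordanEntry (l ∷ ls) (l ℕ.+ i) j ≡ 0#
  entry-lowerLeft l ls i j j<l
    rewrite ≡ᵇ-false-below (ℕ.<-≤-trans j<l (ℕ.≤-trans (ℕ.m≤m+n l i) (ℕ.n≤1+n _))) = refl

  entry-lowerRight : ∀ l ls i j → 0 ℕ.< l → jordanEntry (l ∷ ls) (l ℕ.+ i) (l ℕ.+ j) ≡ jordanEntry ls i j
  entry-lowerRight l@(suc k) ls i j _
    rewrite any-shift l j (blockStarts ls) | sym (ℕ.+-suc k i) | +-≡ᵇ k j (suc i) = refl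

  jordan-∷-≅ : ∀ l ls → 0 ℕ.< l →
               act (jordanBlock {l}) ⊗ act (jordan {sum ls} ls) ≅ act (jordan {sum (l ∷ ls)} (l ∷ ls))
  jordan-∷-≅ l ls 0<l = blocks-≅ (jordan (l ∷ ls)) jordanBlock (jordan ls)
    (λ i j → trans (cong₂ (jordanEntry (l ∷ ls)) (Fin.toℕ-↑ˡ i n) (Fin.toℕ-↑ˡ j n))
      (entry-upperLeft l ls _ _ (Fin.toℕ<n j)))
    (upperRight ls)
    (λ i j → trans (cong₂ (jordanEntry (l ∷ ls)) (Fin.toℕ-↑ʳ l i) (Fin.toℕ-↑ˡ j n))
      (entry-lowerLeft l ls _ _ (Fin.toℕ<n j)))
    (λ i j → trans (cong₂ (jordanEntry (l ∷ ls)) (Fin.toℕ-↑ʳ l i) (Fin.toℕ-↑ʳ l j))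
      (entry-lowerRight l ls _ _ 0<l))
    where
    n = sum ls

    upperRight : ∀ ls i j → jordan {l ℕ.+ sum ls} (l ∷ ls) (i ↑ˡ sum ls) (l ↑ʳ j) ≡ 0#
    -- An empty tail leaves no columns on the right, hence the single clause.
    upperRight (l₂ ∷ ls) i j =
      trans (cong₂ (jordanEntry (l ∷ l₂ ∷ ls)) (Fin.toℕ-↑ˡ i (sum (l₂ ∷ ls))) (Fin.toℕ-↑ʳ l j))
        (entry-upperRight l l₂ ls _ _ (Fin.toℕ<n i))

  jordan-≅ : ∀ {ls} → All (0 ℕ.<_) ls → act (jordan {sum ls} ls) ≅ nil ls
  jordan-≅ [] = conj (mk↔ₛ′ (λ _ → tt) (λ _ → []) (λ _ → refl) (λ { [] → refl })) (λ _ → refl)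
  jordan-≅ {l ∷ ls} (0<l ∷ ps) = ≅-trans (≅-sym (jordan-∷-≅ l ls 0<l))
    (⊗-cong (≅-reflexive act-jordanBlock) (jordan-≅ ps))

-- Products and fibres of restrictions

module _ {X X′ Y Y′ K L : Set} {t : X → X} {t′ : Y → Y} {u : X′ → X′} {u′ : Y′ → Y′} where

  collapse-⊗ : Collapse K t t′ → Collapse L u u′ → Collapse (K × L) (t ⊗ u) (t′ ⊗ u′)
  collapse-⊗ c d = record
    { split = ↔-trans (C.split ×-↔ D.split)
        (mk↔ₛ′ (λ ((y , k) , (y′ , l)) → (y , y′) , (k , l)) (λ ((y , y′) , (k , l)) → (y , k) , (y′ , l))
          (λ _ → refl) (λ _ → refl))
    ; ι = Product.map C.ι D.ι
    ; ι-injective = λ eq → cong₂ _,_ (C.ι-injective (cong proj₁ eq)) (D.ι-injective (cong proj₂ eq))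
    ; factors = λ (x , x′) → cong₂ _,_ (C.factors x) (D.factors x′)
    ; induced = λ (y , y′) → cong₂ _,_ (C.induced y) (D.induced y′)
    }
    where module C = Collapse c
          module D = Collapse d

module _ {X Y K : Set} {t : X → X} {t′ : Y → Y} where

  collapse-fibre : {L : Set} → K ↔ L → Collapse K t t′ → Collapse L t t′
  collapse-fibre b c = record
    { split = ↔-trans split (↔-refl ×-↔ b)
    ; ι = ι; ι-injective = ι-injective; factors = factors; induced = induced }
    where open Collapse c

  module _ {Z W L : Set} {u : Z → Z} {u′ : W → W} (c : Collapse K t t′) (d : Collapse L u u′)
           (e : t′ ≅ u) (w : W) where
    private
      module C = Collapse c
      module D = Collapse d
      module E = _≅_ e

      point : L → Y
      point l = E.from (Inverse.from D.split (w , l))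

      p-ι-point : ∀ l → C.p (C.ι (point l)) ≡ E.from (D.ι w)
      p-ι-point l = begin
        C.p (C.ι (point l))                             ≡⟨ C.induced (point l) ⟨
        t′ (point l)                                    ≡⟨ E.commute⁻¹ _ ⟨
        E.from (u (Inverse.from D.split (w , l)))       ≡⟨ cong E.from (D.factors _) ⟩
        E.from (D.ι (D.p (Inverse.from D.split (w , l))))
          ≡⟨ cong (E.from ∘ D.ι ∘ proj₁) (Inverse.strictlyInverseˡ D.split (w , l)) ⟩
        E.from (D.ι w)                                  ∎
        where open ≡-Reasoning

    -- The fibre of `u` over `w` is carried into `Y` and embedded by `C.ι`. There it lies in a
    -- single fibre of `C.p`, because `C.p ∘ C.ι` is `t′`, which is constant on it. So fibres of the
    -- restriction are no larger than those of `t`.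
    fibreMap : L → K
    fibreMap l = proj₂ (Inverse.to C.split (C.ι (point l)))

    fibreMap-injective : Injective _≡_ _≡_ fibreMap
    fibreMap-injective {k} {l} eq = cong proj₂ (↔-injective (↔-sym D.split)
      (↔-injective (↔-sym E.bijection) (C.ι-injective (↔-injective C.split
        (cong₂ _,_ (trans (p-ι-point k) (sym (p-ι-point l))) eq)))))

-- The image is identified with `X` through `u` itself, so restricting gives back `u`; this is why
-- the invertible part survives every restriction.
collapse-injective : {X : Set} {u : X → X} → Injective _≡_ _≡_ u → Collapse ⊤ u u
collapse-injective {u = u} inj = record
  { split = mk↔ₛ′ (λ x → x , tt) proj₁ (λ _ → refl) (λ _ → refl)
  ; ι = u; ι-injective = inj; factors = λ _ → refl; induced = λ _ → refl }

-- Arithmetic of block lengths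

All-≤-sum : ∀ ls → All (_≤ sum ls) ls
All-≤-sum [] = []
All-≤-sum (l ∷ ls) = ℕ.m≤m+n l (sum ls) ∷ All.map (λ p → ℕ.≤-trans p (ℕ.m≤n+m (sum ls) l))
  (All-≤-sum ls)

sum-map-suc : ∀ ls → sum (map suc ls) ≡ length ls ℕ.+ sum ls
sum-map-suc [] = refl
sum-map-suc (l ∷ ls) = cong suc (trans (cong (l ℕ.+_) (sum-map-suc ls))
  (trans (sym (ℕ.+-assoc l _ _)) (trans (cong (ℕ._+ sum ls) (ℕ.+-comm l _)) (ℕ.+-assoc (length ls) l _))))

sum-replicate-0 : ∀ t → sum (List.replicate t 0) ≡ 0
sum-replicate-0 zero = refl
sum-replicate-0 (suc t) = sum-replicate-0 t

map-∸-suc : ∀ k ls → map (_∸ k) (map pred ls) ≡ map (_∸ suc k) ls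
map-∸-suc k ls = trans (sym (List.map-∘ ls)) (List.map-cong (pred-∸ k) ls)
  where
  pred-∸ : ∀ k n → pred n ∸ k ≡ n ∸ suc k
  pred-∸ k zero = ℕ.0∸n≡0 k
  pred-∸ k (suc n) = refl

++-zeros-descending : ∀ {ls} t → Linked _≥_ ls → Linked _≥_ (ls List.++ List.replicate t 0)
++-zeros-descending zero [] = []
++-zeros-descending (suc zero) [] = [-]
++-zeros-descending (suc (suc t)) [] = z≤n ∷ ++-zeros-descending (suc t) []
++-zeros-descending zero [-] = [-]
++-zeros-descending (suc t) [-] = z≤n ∷ ++-zeros-descending (suc t) []
++-zeros-descending t (l≥m ∷ lk) = l≥m ∷ ++-zeros-descending t lk

⊤-⊗ : {X : Set} {u : X → X} → id {A = ⊤} ⊗ u ≅ u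
⊤-⊗ = conj (mk↔ₛ′ proj₂ (tt ,_) (λ _ → refl) (λ _ → refl)) (λ _ → refl)

-- Sums of nilpotent shifts and an invertible map

module Systems (𝔽 : FiniteField) where
  open LinAlg 𝔽
  open Field 𝔽
  open Matrices 𝔽
  open FiniteField 𝔽 using (0#)

  nil-cong : ∀ {ls ms} → ls ≡ ms → nil ls ≅ nil ms
  nil-cong refl = ≅-refl

  nil-↭ : ∀ {ls ms} → ls ↭ ms → nil ls ≅ nil ms
  nil-↭ Perm.refl = ≅-refl
  nil-↭ (Perm.prep l σ) = ⊗-cong ≅-refl (nil-↭ σ)
  nil-↭ (Perm.swap l m σ) = ≅-trans (≅-sym ⊗-assoc)
    (≅-trans (⊗-cong ⊗-comm (nil-↭ σ)) ⊗-assoc)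
  nil-↭ (Perm.trans σ τ) = ≅-trans (nil-↭ σ) (nil-↭ τ)

  nil-++ : ∀ ls ms → nil (ls List.++ ms) ≅ nil ls ⊗ nil ms
  nil-++ [] ms = ≅-sym ⊤-⊗
  nil-++ (l ∷ ls) ms = ≅-trans (⊗-cong ≅-refl (nil-++ ls ms)) (≅-sym ⊗-assoc)

  nil-zeros : ∀ {ls} → All (_≡ 0) ls → nil ls ≅ id {A = ⊤}
  nil-zeros [] = ≅-refl
  nil-zeros (refl ∷ ps) = ≅-trans (⊗-cong V0 (nil-zeros ps)) ⊤-⊗
    where
    V0 : shift {0} ≅ id {A = ⊤}
    V0 = conj (mk↔ₛ′ (λ _ → tt) (λ _ → []) (λ _ → refl) (λ { [] → refl })) (λ _ → refl)

  Blocks-↔ : ∀ ls → Blocks ls ↔ V (sum ls)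
  Blocks-↔ [] = mk↔ₛ′ (λ _ → []) (λ _ → tt) (λ { [] → refl }) (λ _ → refl)
  Blocks-↔ (l ∷ ls) = ↔-trans (↔-refl ×-↔ Blocks-↔ ls) (++-↔ l (sum ls))

  Blocks×V-↔ : ∀ ls m → (Blocks ls × V m) ↔ V (sum ls ℕ.+ m)
  Blocks×V-↔ ls m = ↔-trans (Blocks-↔ ls ×-↔ ↔-refl) (++-↔ (sum ls) m)

  -- The fibre of a shift is the coordinate it forgets; an empty block forgets nothing.
  Head : ℕ → Set
  Head zero    = ⊤
  Head (suc _) = F

  Heads : List ℕ → Set
  Heads []       = ⊤
  Heads (l ∷ ls) = Head l × Heads ls

  heads₀ : ∀ ls → Heads ls
  heads₀ []           = tt
  heads₀ (zero ∷ ls)  = tt , heads₀ ls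
  heads₀ (suc _ ∷ ls) = 0# , heads₀ ls

  Heads-↔ : ∀ {ls} → All (0 <_) ls → Heads ls ↔ V (length ls)
  Heads-↔ [] = mk↔ₛ′ (λ _ → []) (λ _ → tt) (λ { [] → refl }) (λ _ → refl)
  Heads-↔ (s≤s _ ∷ ps) = ↔-trans (↔-refl ×-↔ Heads-↔ ps)
    (mk↔ₛ′ (λ (x , v) → x ∷ v) (λ v → head v , tail v) (λ { (_ ∷ _) → refl }) (λ _ → refl))

  -- The image consists of the vectors ending in zero; without that zero they form a block one
  -- shorter.
  shift-collapse : ∀ l → Collapse (Head l) (shift {l}) (shift {pred l})
  shift-collapse zero = collapse-injective λ { {[]} {[]} _ → refl }
  shift-collapse (suc l) = record
    { split = mk↔ₛ′ (λ v → tail v , head v) (λ (v , x) → x ∷ v) (λ _ → refl) (λ { (_ ∷ _) → refl })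
    ; ι = _∷ʳ 0#
    ; ι-injective = Vec.∷ʳ-injectiveˡ _ _
    ; factors = λ { (_ ∷ _) → refl }
    ; induced = λ { [] → refl ; (_ ∷ _) → refl }
    }

  nil-collapse : ∀ ls → Collapse (Heads ls) (nil ls) (nil (map pred ls))
  nil-collapse [] = collapse-injective λ eq → eq
  nil-collapse (l ∷ ls) = collapse-⊗ (shift-collapse l) (nil-collapse ls)

  nil-⊗-collapse : ∀ ls {m} {u : V m → V m} → Injective _≡_ _≡_ u →
                   Collapse (Heads ls × ⊤) (nil ls ⊗ u) (nil (map pred ls) ⊗ u)
  nil-⊗-collapse ls inj = collapse-⊗ (nil-collapse ls) (collapse-injective inj)

  nil-⊗-collapse⁺ : ∀ {ls} → All (0 <_) ls → ∀ {m} {u : V m → V m} → Injective _≡_ _≡_ u →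
                    Collapse (V (length ls)) (nil ls ⊗ u) (nil (map pred ls) ⊗ u)
  nil-⊗-collapse⁺ {ls} pos inj = collapse-fibre
    (↔-trans (mk↔ₛ′ proj₁ (_, tt) (λ _ → refl) (λ _ → refl)) (Heads-↔ pos)) (nil-⊗-collapse ls inj)

  -- Uniqueness of block lengths and invertible part

  module _ {m m′} {u : V m → V m} {u′ : V m′ → V m′}
           (inj : Injective _≡_ _≡_ u) (inj′ : Injective _≡_ _≡_ u′) where

    truncate-≅ : ∀ k {ls ms} → nil ls ⊗ u ≅ nil ms ⊗ u′ →
                 nil (map (_∸ k) ls) ⊗ u ≅ nil (map (_∸ k) ms) ⊗ u′
    truncate-≅ zero {ls} {ms} =
      subst₂ (λ a b → nil a ⊗ u ≅ nil b ⊗ u′) (sym (List.map-id ls)) (sym (List.map-id ms))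
    truncate-≅ (suc k) {ls} {ms} e =
      subst₂ (λ a b → nil a ⊗ u ≅ nil b ⊗ u′) (map-∸-suc k ls) (map-∸-suc k ms)
        (truncate-≅ k (collapse-≅ (nil-⊗-collapse ls inj) (nil-⊗-collapse ms inj′)
          (heads₀ ls , tt) (heads₀ ms , tt) e))

    truncate-all : ∀ {k ls m} {v : V m → V m} → All (_≤ k) ls → nil (map (_∸ k) ls) ⊗ v ≅ v
    truncate-all ps = ≅-trans (⊗-cong (nil-zeros (All.map⁺ (All.map ℕ.m≤n⇒m∸n≡0 ps))) ≅-refl) ⊤-⊗

    bijective-part-unique : ∀ {ls ms} → nil ls ⊗ u ≅ nil ms ⊗ u′ → u ≅ u′
    -- The number `sum ls + sum ms` bounds all blocks of both lists, so that many restrictions leave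
    -- only the invertible parts.
    bijective-part-unique {ls} {ms} e = ≅-trans (≅-sym (truncate-all
        (All.map (λ p → ℕ.≤-trans p (ℕ.m≤m+n (sum ls) (sum ms))) (All-≤-sum ls))))
      (≅-trans (truncate-≅ (sum ls ℕ.+ sum ms) e) (truncate-all
        (All.map (λ p → ℕ.≤-trans p (ℕ.m≤n+m (sum ms) (sum ls))) (All-≤-sum ms))))

    nil-part-unique : ∀ {ls ms} → Linked _≥_ ls → Linked _≥_ ms → All (0 <_) ls → All (0 <_) ms →
                      nil ls ⊗ u ≅ nil ms ⊗ u′ → ls ≡ ms
    nil-part-unique {ls} {ms} sl sm pl pm e = descending-unique sl sm pl pm λ k →
      ℕ.+-cancelʳ-≡ m _ _ (trans (V-↔⇒≡ (↔-trans (↔-sym (Blocks×V-↔ (map (_∸ k) ls) m))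
        (↔-trans (_≅_.bijection (truncate-≅ k e)) (Blocks×V-↔ (map (_∸ k) ms) m′))))
        (cong (sum (map (_∸ k) ms) ℕ.+_) (sym m≡m′)))
      where
      m≡m′ : m ≡ m′
      m≡m′ = V-↔⇒≡ (_≅_.bijection (bijective-part-unique e))

  -- Existence of the decomposition

  -- A Fitting decomposition up to dynamical equivalence: the bijection in `equivalent` is one of
  -- sets.
  record Decomposition {n} (T : V n → V n) : Set where
    field
      blocks     : List ℕ
      descending : Linked _≥_ blocks
      positive   : All (0 <_) blocks
      m          : ℕ
      sum+m≡n    : sum blocks ℕ.+ m ≡ n
      U          : Matrix m
      invertible : Invertible U
      equivalent : T ≅ nil blocks ⊗ act U

  blocks₀ : ∀ ls → Blocks ls
  blocks₀ []       = tt
  blocks₀ (l ∷ ls) = 𝟘 , blocks₀ ls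

  decompose-bijection : ∀ {n} {T : V n → V n} → Linear T → Injective _≡_ _≡_ T → Decomposition T
  decompose-bijection {n} {T} lin inj = record
    { blocks = []; descending = []; positive = []; m = n; sum+m≡n = refl
    ; U = toMatrix T
    ; invertible = linear-bijection⇒Invertible
        (mk↔ₛ′ T (λ w → proj₁ (surj w)) (λ w → proj₂ (surj w)) (λ v → inj (proj₂ (surj (T v))))) lin
    ; equivalent = ≅-trans (≅-reflexive (λ v → sym (act-toMatrix lin v))) (≅-sym ⊤-⊗)
    }
    where surj = injective⇒surjective inj

  -- Passing from the image of T to T lengthens every Jordan block by one and
  -- adds s − #blocks new blocks of length one, where s = dim ker T.
  decompose-extend : ∀ {n} {T : V n → V n} (φ : Factorization T) → let open Factorization φ in
                     Decomposition (p ∘ ι) → Decomposition T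
  decompose-extend {n} {T} φ δ = record
    { blocks = bs; descending = Linked.map⁺ (Linked.map s≤s (++-zeros-descending t descending))
    ; positive = positive⁺; m = m; sum+m≡n = sum≡
    ; U = U; invertible = invertible
    ; equivalent = extend-≅ _≟ᴮ_ (_ , V-enum r) (factorization⇒collapse φ) collapse⁺ reduced }
    where
    open Factorization φ
    open Decomposition δ

    U-injective : Injective _≡_ _≡_ (act U)
    U-injective = ↔-injective (act-↔ invertible)

    -- All blocks are positive, so the fibres of the restriction have dimension `length blocks`;
    -- `fibreMap` embeds one into a fibre of `T`, of dimension `s`.
    #blocks≤s : length blocks ≤ s
    #blocks≤s = V-injection⇒≤ (fibreMap-injective (factorization⇒collapse φ)
      (nil-⊗-collapse⁺ positive U-injective) equivalent (blocks₀ _ , 𝟘))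

    t = s ∸ length blocks
    -- Padding by empty blocks does not change the restriction, and `map suc` turns them into the
    -- new blocks of length one. Now the number of blocks is exactly `s`, so both fibres are `V s`.
    cs = blocks List.++ List.replicate t 0
    bs = map suc cs

    positive⁺ : All (0 <_) bs
    positive⁺ = All.map⁺ (All.universal (λ _ → s≤s z≤n) cs)

    length-cs : length cs ≡ s
    length-cs = trans (List.length-++ blocks) (trans (cong (length blocks ℕ.+_) (List.length-replicate t))
      (ℕ.m+[n∸m]≡n #blocks≤s))

    sum-cs : sum cs ≡ sum blocks
    sum-cs = trans (sum-++ blocks _) (trans (cong (sum blocks ℕ.+_) (sum-replicate-0 t)) (ℕ.+-identityʳ _))

    sum≡ : sum bs ℕ.+ m ≡ n
    sum≡ = begin
      sum bs ℕ.+ m                  ≡⟨ cong (ℕ._+ m) (sum-map-suc cs) ⟩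
      length cs ℕ.+ sum cs ℕ.+ m    ≡⟨ cong₂ (λ a b → a ℕ.+ b ℕ.+ m) length-cs sum-cs ⟩
      s ℕ.+ sum blocks ℕ.+ m        ≡⟨ ℕ.+-assoc s _ m ⟩
      s ℕ.+ (sum blocks ℕ.+ m)      ≡⟨ cong (s ℕ.+_) sum+m≡n ⟩
      s ℕ.+ r                       ≡⟨ ℕ.+-comm s r ⟩
      r ℕ.+ s                       ≡⟨ r+s≡n ⟩
      n                             ∎
      where open ≡-Reasoning

    collapse⁺ : Collapse (V s) (nil bs ⊗ act U) (nil cs ⊗ act U)
    collapse⁺ = subst₂ (λ k ls → Collapse (V k) (nil bs ⊗ act U) (nil ls ⊗ act U))
      (trans (List.length-map suc cs) length-cs)
      (trans (sym (List.map-∘ cs)) (List.map-id cs))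
      (nil-⊗-collapse⁺ positive⁺ U-injective)

    reduced : p ∘ ι ≅ nil cs ⊗ act U
    reduced = ≅-trans equivalent (⊗-cong (≅-sym (≅-trans (nil-++ blocks _)
      (≅-trans ⊗-comm (≅-trans (⊗-cong (nil-zeros (All.replicate⁺ t refl)) ≅-refl) ⊤-⊗)))) ≅-refl)

    _≟ᴮ_ : DecidableEquality (Blocks bs × V m)
    x ≟ᴮ y = map′ (↔-injective b) (cong (Inverse.to b)) (Inverse.to b x ≟ⱽ Inverse.to b y)
      where b = Blocks×V-↔ bs m

  decompose : ∀ n {T : V n → V n} → Linear T → Decomposition T
  decompose = <-rec _ step
    where
    step : ∀ n → (∀ {k} → k < n → {T : V k → V k} → Linear T → Decomposition T) →
           {T : V n → V n} → Linear T → Decomposition T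
    step n rec {T} lin with factorize T lin
    -- A nonzero kernel makes the rank smaller than `n`, so the induction hypothesis covers the
    -- restriction; with zero kernel `T` is injective.
    ... | φ@record { s = suc s; r+s≡n = r+s≡n } = decompose-extend φ (rec
      (ℕ.≤-trans (ℕ.m<m+n r (s≤s z≤n)) (ℕ.≤-reflexive r+s≡n))
      (λ a u v → trans (cong p (ι-linear a u v)) (p-linear a (ι u) (ι v))))
      where open Factorization φ hiding (s; r+s≡n)
    ... | φ@record { s = zero } = decompose-bijection lin λ {v} {w} eq →
      ↔-injective split (cong₂ _,_ (ι-injective (trans (sym (factors v)) (trans eq (factors w)))) (V0 _ _))
      where
      open Factorization φ
      V0 : (x y : V 0) → x ≡ y
      V0 [] [] = refl

  -- Dynamical equivalence and Jordan types

  module _ {n} {S T : Matrix n} where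

    ∼⇒≅ : T ∼ S → act S ≅ act T
    ∼⇒≅ (f , g , g∘f , f∘g , comm) = conj (mk↔ₛ′ f g f∘g g∘f) comm

    ≅⇒∼ : act S ≅ act T → T ∼ S
    ≅⇒∼ e = to , from , strictlyInverseʳ , strictlyInverseˡ , commute
      where open _≅_ e

  jordan-≅-nil : ∀ {n ls} → All (0 <_) ls → sum ls ≡ n → act (jordan {n} ls) ≅ nil ls
  jordan-≅-nil pos refl = jordan-≅ pos

  JordanType⇒≅ : ∀ {n} {S : Matrix n} {ls} → JordanType S ls → act S ≅ nil ls
  JordanType⇒≅ {S = S} {ls} (pos , sum≡n , P , P-inv , SP≐PJ) = ≅-trans
    (≅-sym (conj (act-↔ P-inv) λ v → trans (sym (act-· P (jordan ls) v))
      (trans (sym (act-cong SP≐PJ v)) (act-· S P v))))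
    (jordan-≅-nil pos sum≡n)

  open Data.List.Sort (decTotalOrder ℕ.≤-decTotalOrder) using (sort; sort-↭; sort-↗)

  nil-≅⇒↭ : ∀ {ls ms} → All (0 <_) ls → All (0 <_) ms → nil ls ≅ nil ms → ls ↭ ms
  nil-≅⇒↭ {ls} {ms} pl pm e = ↭-trans (↭-sym (sort-↭ ls)) (↭-trans (↭-reflexive sorted≡) (sort-↭ ms))
    where
    sorted≡ : sort ls ≡ sort ms
    -- The identity of the zero-dimensional space plays the invertible part.
    sorted≡ = nil-part-unique {0} {0} {id} {id} (λ eq → eq) (λ eq → eq)
      (sort-↗ ls) (sort-↗ ms) (All-resp-↭ (↭-sym (sort-↭ ls)) pl) (All-resp-↭ (↭-sym (sort-↭ ms)) pm)
      (⊗-cong (≅-trans (nil-↭ (sort-↭ ls)) (≅-trans e (nil-↭ (↭-sym (sort-↭ ms))))) ≅-refl)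

  ∼⇔↭ : ∀ {n} {S T : Matrix n} {ls ms} → JordanType S ls → JordanType T ms → (T ∼ S) ⇔ (ls ↭ ms)
  ∼⇔↭ js@(pl , _) jt@(pm , _) = mk⇔
    (λ T∼S → nil-≅⇒↭ pl pm (≅-trans (≅-sym (JordanType⇒≅ js)) (≅-trans (∼⇒≅ T∼S) (JordanType⇒≅ jt))))
    (λ σ → ≅⇒∼ (≅-trans (JordanType⇒≅ js) (≅-trans (nil-↭ σ) (≅-sym (JordanType⇒≅ jt)))))

  ∼-sym : ∀ {n} {S T : Matrix n} → S ∼ T → T ∼ S
  ∼-sym = ≅⇒∼ ∘ ≅-sym ∘ ∼⇒≅

  ∼-trans : ∀ {n} {S T U : Matrix n} → S ∼ T → T ∼ U → S ∼ U
  ∼-trans r s = ≅⇒∼ (≅-trans (∼⇒≅ s) (∼⇒≅ r))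

  subst-≅ : ∀ {m n} (eq : m ≡ n) (M : Matrix m) → act M ≅ act (subst Matrix eq M)
  subst-≅ refl M = ≅-refl

  -- Classes of all matrices by partition and invertible class

  module _ (n : ℕ) {I J : ℕ → Set}
           (partitions : ∀ {k} → k ≤ n → Classes (IsPartition k) _≡_ (I k))
           (bijections : ∀ {k} → k ≤ n → Classes {Matrix k} Invertible _∼_ (J k)) where
    private
      module Part {k} (k≤n : k ≤ n) = Classes (partitions k≤n)
      module Bij k = Classes (bijections (ℕ.m∸n≤m n k))

      Index : Set
      Index = ∃ λ k → k ≤ n × (I k × J (n ∸ k))

      blocks : ∀ {k} → k ≤ n → I k → List ℕ
      blocks k≤n i = Part.rep k≤n i

      rep : Index → Matrix n
      rep (k , k≤n , i , j) =
        subst Matrix (ℕ.m+[n∸m]≡n k≤n) (diag (jordan {k} (blocks k≤n i)) (Bij.rep k j))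

      rep-≅ : ∀ {k} (k≤n : k ≤ n) i j →
              nil (blocks k≤n i) ⊗ act (Bij.rep k j) ≅ act (rep (k , k≤n , i , j))
      rep-≅ k≤n i j with Part.rep-sat k≤n i
      ... | _ , pos , sum≡k = ≅-trans (⊗-cong (≅-sym (jordan-≅-nil pos sum≡k)) ≅-refl)
        (≅-trans (diag-≅ _ _) (subst-≅ (ℕ.m+[n∸m]≡n k≤n) _))

      distinct : ∀ x y → rep x ∼ rep y → x ≡ y
      distinct (k , k≤n , i , j) (k′ , k′≤n , i′ , j′) r =
        match (trans (sym sum≡k) (trans (cong sum blocks≡) sum≡k′)) k≤n k′≤n i i′ j j′
          blocks≡ (bijective-part-unique inj inj′ e)
        where
        sat = Part.rep-sat k≤n i
        sat′ = Part.rep-sat k′≤n i′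
        sum≡k = proj₂ (proj₂ sat)
        sum≡k′ = proj₂ (proj₂ sat′)
        inj = ↔-injective (act-↔ (Bij.rep-sat k j))
        inj′ = ↔-injective (act-↔ (Bij.rep-sat k′ j′))
        e = ≅-trans (rep-≅ k≤n i j) (≅-trans (≅-sym (∼⇒≅ r)) (≅-sym (rep-≅ k′≤n i′ j′)))
        blocks≡ = nil-part-unique inj inj′ (proj₁ sat) (proj₁ sat′)
          (proj₁ (proj₂ sat)) (proj₁ (proj₂ sat′)) e

        -- The equality `k ≡ k′`, obtained from the sums of equal block lists, comes first: only
        -- then do the remaining indices live in the same sets.
        match : ∀ {k k′} → k ≡ k′ → ∀ k≤n k′≤n (i : I k) (i′ : I k′) j j′ →
                blocks k≤n i ≡ blocks k′≤n i′ → act (Bij.rep k j) ≅ act (Bij.rep k′ j′) →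
                _≡_ {A = Index} (k , k≤n , i , j) (k′ , k′≤n , i′ , j′)
        match {k} refl k≤n k′≤n i i′ j j′ eq f with ℕ.≤-irrelevant k≤n k′≤n
        ... | refl = cong₂ (λ i j → k , k≤n , i , j)
          (Part.distinct k≤n i i′ eq) (Bij.distinct k j j′ (≅⇒∼ (≅-sym f)))

      classify : ∀ T → ∃ λ x → T ∼ rep x
      classify T = x , ≅⇒∼ (≅-trans (≅-sym (rep-≅ k≤n (proj₁ part) (proj₁ bij))) (≅-trans
          (⊗-cong (nil-cong (sym (proj₂ part)))
                  (≅-trans (∼⇒≅ (proj₂ bij)) (≅-sym (subst-≅ m≡n∸k U))))
          (≅-sym equivalent)))
        where
        open Decomposition (decompose n (act-linear T)) renaming (blocks to ls)
        k = sum ls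
        k≤n : k ≤ n
        k≤n = ℕ.≤-trans (ℕ.m≤m+n k m) (ℕ.≤-reflexive sum+m≡n)
        -- The matrix `U` has size `m`, equal to `n ∸ k` only propositionally, so it is transported
        -- before its class is looked up.
        m≡n∸k : m ≡ n ∸ k
        m≡n∸k = trans (sym (ℕ.m+n∸m≡n k m)) (cong (_∸ k) sum+m≡n)

        subst-Invertible : ∀ {m m′} (eq : m ≡ m′) {U : Matrix m} →
                           Invertible U → Invertible (subst Matrix eq U)
        subst-Invertible refl inv = inv

        part = Part.classify k≤n ls (descending , positive , refl)
        bij = Bij.classify k (subst Matrix m≡n∸k U) (subst-Invertible m≡n∸k invertible)
        x : Index
        x = k , k≤n , proj₁ part , proj₁ bij

    matrixClasses : Classes {Matrix n} (λ _ → ⊤) _∼_ (∃ λ k → k ≤ n × (I k × J (n ∸ k)))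
    matrixClasses = record
      { rep = rep; rep-sat = λ _ → tt; distinct = distinct; classify = λ T _ → classify T }

open import Data.Nat using (_*_)

theorem2 : (𝔽 : FiniteField) → let open LinAlg 𝔽 in
    ((n : ℕ) (S T : Matrix n) → Nilpotent S → Nilpotent T →
    (λs μs : List ℕ) → JordanType S λs → JordanType T μs →
    ((T ∼ S) ⇔ (λs ↭ μs)))
    ×
    ((n : ℕ) (P : ℕ → ℕ) (B : ℕ → ℕ) (A : ℕ) →
    (∀ k → k ≤ n → PartitionCount k (P k)) →
    (∀ k → k ≤ n → BijCount k (B k)) →
    AllCount n A →
    A ≡ sumTo n (λ k → P k * B (n ∸ k)))
theorem2 𝔽 =
  (λ n S T _ _ λs μs js jt → ∼⇔↭ js jt) ,
  -- Two systems of representatives for all matrices are compared: one indexed by `Fin A`, the other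
  -- by triples of `k ≤ n`, a partition of `k` and a class of bijections in dimension `n ∸ k`.
  (λ n P B A #partitions #bijections #all → Fin↔⇒≡ (↔-trans
    (Classes-unique ∼-trans (HasCard⇒Classes ∼-sym #all)
      (matrixClasses n (λ k≤n → HasCard⇒Classes sym (#partitions _ k≤n))
                       (λ k≤n → HasCard⇒Classes ∼-sym (#bijections _ k≤n))))
    (sumTo-↔ _ _ (λ k → ↔-sym Fin.*↔×) n)))
  where open Systems 𝔽
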